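{- Let $\sigma\in\{st,co,gr,pr,se,id,ea,na,stg\}$, let $\mathsf{CAF}=(F,U,C)$ be a control argumentation framework with $F=(A^F,R^F)$, $U=(A^?,R^?\cup R^{\leftrightarrow})$, $C=(A^C,R^C)$, and let $a\in A^F$. Then: (1) the answer to $\sigma$-NSCon with input $\mathsf{CAF}$ and $a$ is yes iff $v_{\mathsf{CAF}}\models\langle\mathsf{control}^{\mathsf{CAF}}\rangle[\mathsf{makeComp}^{\mathsf{CAF}};\mathsf{makeExt}^\sigma]\mathtt{in}_a$; (2) the answer to $\sigma$-NCCon with input $\mathsf{CAF}$ and $a$ is yes iff $v_{\mathsf{CAF}}\models\langle\mathsf{control}^{\mathsf{CAF}}\rangle[\mathsf{makeComp}^{\mathsf{CAF}}]\langle\mathsf{makeExt}^\sigma\rangle\mathtt{in}_a$; (3) the answer to $\sigma$-PCCon with input $\mathsf{CAF}$ and $a$ is yes iff $v_{\mathsf{CAF}}\models\langle\mathsf{control}^{\mathsf{CAF}};\mathsf{makeComp}^{\mathsf{CAF}};\mathsf{makeExt}^\sigma\rangle\mathtt{in}_a$; (4) the answer to $\sigma$-PSCon with input $\mathsf{CAF}$ and $a$ is yes iff $v_{\mathsf{CAF}}\models\langle\mathsf{control}^{\mathsf{CAF}};\mathsf{makeComp}^{\mathsf{CAF}}\rangle[\mathsf{makeExt}^\sigma]\mathtt{in}_a$.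
   Context: **Argumentation.** Fix a finite non-empty set $\mathcal U$ of arguments. For $A\subseteq\mathcal U$, $R\subseteq\mathcal U\times\mathcal U$, let $R\upharpoonright_A=R\cap(A\times A)$. An argumentation framework (AF) is a pair $(A,R)$ with $A\subseteq\mathcal U$, $R\subseteq A\times A$. For $E\subseteq A$: $E^+=\{x\in A\mid\exists y\in E:(y,x)\in R\}$, $E^\oplus=E\cup E^+$ (range). $E$ is conflict-free iff $E\cap E^+=\emptyset$; $E$ defends $a\in A$ iff every $x\in A$ with $(x,a)\in R$ is in $E^+$; $E$ is admissible iff it is conflict-free and defends all its members. $\sigma(A,R)$ denotes the set of $\sigma$-extensions of $(A,R)$, where $E\subseteq A$ is: stable ($st$) iff conflict-free and $A\setminus E\subseteq E^+$; complete ($co$) iff conflict-free and $E$ contains precisely the arguments of $A$ it defends; grounded ($gr$) iff a $\subseteq$-minimal complete extension; preferred ($pr$) iff a $\subseteq$-maximal complete extension; semi-stable ($se$) iff complete and there is no complete $E'$ with $E^\oplus\subset E'^\oplus$ (strict); ideal ($id$) iff the $\subseteq$-maximal ideal set, an ideal set being an admissible set contained in every preferred extension; eager ($ea$) iff the $\subseteq$-maximal eager set, an eager set being an admissible set contained in every semi-stable extension; naive ($na$) iff a $\subseteq$-maximal conflict-free set; stage ($stg$) iff conflict-free with $\subseteq$-maximal range among conflict-free sets. **Control AFs.** A control AF (CAF) is a triple $(F,U,C)$ with $F=(A^F,R^F)$ (fixed part), $U=(A^?,R^?\cup R^{\leftrightarrow})$ (uncertain part), $C=(A^C,R^C)$ (control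 part), where $A^F,A^?,A^C\subseteq\mathcal U$ are pairwise disjoint; $R^F,R^?,R^{\leftrightarrow}\subseteq(A^F\cup A^?)\times(A^F\cup A^?)$; $R^{\leftrightarrow}$ is symmetric and irreflexive; $R^C\subseteq(A^C\times(A^F\cup A^?\cup A^C))\cup((A^F\cup A^?\cup A^C)\times A^C)$; and $R^F,R^?,R^{\leftrightarrow},R^C$ are pairwise disjoint. A completion of a CAF is any AF $(A^*,R^*)$ with $A^F\cup A^C\subseteq A^*\subseteq A^F\cup A^C\cup A^?$; $(R^F\cup R^C)\upharpoonright_{A^*}\subseteq R^*\subseteq(R^F\cup R^C\cup R^?\cup R^{\leftrightarrow})\upharpoonright_{A^*}$; and for all $x,y\in A^*$, $(x,y)\in R^{\leftrightarrow}$ implies $(x,y)\in R^*$ or $(y,x)\in R^*$. A control configuration is a subset $CFG\subseteq A^C$; its associated CAF, $\mathsf{CAF}_{CFG}$, is obtained from $\mathsf{CAF}$ by replacing $C$ with $(CFG,R^C\upharpoonright_{A^F\cup A^?\cup CFG})$. Decision problems for input a CAF and $a\in A^F$: is there a control configuration $CFG\subseteq A^C$ such that: ($\sigma$-NSCon) for every completion $(A^*,R^*)$ of $\mathsf{CAF}_{CFG}$ and every $E\in\sigma(A^*,R^*)$, $a\in E$; ($\sigma$-NCCon) for every completion $(A^*,R^*)$ of $\mathsf{CAF}_{CFG}$ there is $E\in\sigma(A^*,R^*)$ with $a\in E$; ($\sigma$-PCCon) there are a completion $(A^*,R^*)$ of $\mathsf{CAF}_{CFG}$ and $E\in\sigma(A^*,R^*)$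 with $a\in E$; ($\sigma$-PSCon) there is a completion $(A^*,R^*)$ of $\mathsf{CAF}_{CFG}$ such that $a\in E$ for every $E\in\sigma(A^*,R^*)$. **DL-PA.** $\mathtt{Prp}$ is a countably infinite set of propositional variables containing the pairwise distinct variables $\mathtt{aw}_x$, $\mathtt{in}_x$ ($x\in\mathcal U$), $\mathtt r_{x,y}$ ($x,y\in\mathcal U$), and further fresh variables $\mathtt{in}'_x$ ($x\in\mathcal U$). Let $\mathsf{IN}_{\mathcal U}=\{\mathtt{in}_x\mid x\in\mathcal U\}$, $\mathsf{AW}_A=\{\mathtt{aw}_x\mid x\in A\}$, $\mathsf{ATT}_R=\{\mathtt r_{x,y}\mid(x,y)\in R\}$. Formulas and programs: $\varphi::=p\mid\neg\varphi\mid(\varphi\wedge\varphi)\mid[\pi]\varphi$ and $\pi::=+p\mid -p\mid\varphi?\mid(\pi;\pi)\mid(\pi\cup\pi)\mid\pi^{ -1}$, $p\in\mathtt{Prp}$. Valuations are subsets $v\subseteq\mathtt{Prp}$; $v\models p$ iff $p\in v$; Booleans as usual; $v\models[\pi]\varphi$ iff $v'\models\varphi$ for all $v'$ with $(v,v')\in||\pi||$; $\langle\pi\rangle\varphi=\neg[\pi]\neg\varphi$. Programs are interpreted by $||+p||=\{(v,v\cup\{p\})\}$, $||-p||=\{(v,v\setminus\{p\})\}$, $||\varphi?||=\{(v,v)\mid v\models\varphi\}$, $;$ is relation composition, $\cup$ is union, $\pi^{ -1}$ is the inverse relation. $\mathsf{skip}=\top?$. For finite $P=\{p_1,\dots,p_n\}\subseteq\mathtt{Prp}$: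 $\mathsf{mkTrueOne}(P)=\bigcup_{p\in P}(\neg p?;+p)$, $\mathsf{mkFalseOne}(P)=\bigcup_{p\in P}(p?;-p)$, $\mathsf{mkTrueSome}(P)=(+p_1\cup\mathsf{skip});\dots;(+p_n\cup\mathsf{skip})$, $\mathsf{mkFalseSome}(P)=(-p_1\cup\mathsf{skip});\dots;(-p_n\cup\mathsf{skip})$, $\mathsf{vary}(P)=(+p_1\cup -p_1);\dots;(+p_n\cup -p_n)$ (empty sequences and unions are $\mathsf{skip}$). **Extension programs.** For each $\sigma$, $\mathsf{makeExt}^\sigma=\mathsf{vary}(\mathsf{IN}_{\mathcal U});\varphi_\sigma?$, where $\varphi_{st}=\mathsf{Stable}$, $\varphi_{co}=\mathsf{Complete}$, $\varphi_{gr}=\mathsf{Grounded}$, $\varphi_{pr}=\mathsf{Preferred}$, $\varphi_{na}=\mathsf{Naive}$, $\varphi_{se}=\mathsf{SemiStable}$, $\varphi_{stg}=\mathsf{Stage}$, $\varphi_{id}=\mathsf{Ideal}$, $\varphi_{ea}=\mathsf{Eager}$ are the following (all indices range over $\mathcal U$): $\mathsf{Well}=\bigwedge_x(\mathtt{in}_x\to\mathtt{aw}_x)$; $\mathsf{ConFree}=\mathsf{Well}\wedge\bigwedge_x\bigwedge_y\neg(\mathtt{in}_x\wedge\mathtt{in}_y\wedge\mathtt r_{x,y})$; $\mathsf{Admissible}=\mathsf{ConFree}\wedge\bigwedge_x(\mathtt{in}_x\to\bigwedge_y((\mathtt{aw}_y\wedge\mathtt r_{y,x})\to\bigvee_z(\mathtt{in}_z\wedge\mathtt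 r_{z,y})))$; $\mathsf{copy}(\mathsf{IN}_{\mathcal U})$ = sequential composition over $x\in\mathcal U$ of $(\mathtt{in}_x?;+\mathtt{in}'_x)\cup(\neg\mathtt{in}_x?;-\mathtt{in}'_x)$; $\mathsf{Rg}_x=\mathtt{in}_x\vee(\mathtt{aw}_x\wedge\bigvee_y(\mathtt{in}_y\wedge\mathtt r_{y,x}))$, $\mathsf{Rg}'_x=\mathtt{in}'_x\vee(\mathtt{aw}_x\wedge\bigvee_y(\mathtt{in}'_y\wedge\mathtt r_{y,x}))$, $\mathsf{IncludedInCp}=\bigwedge_x(\mathsf{Rg}_x\to\mathsf{Rg}'_x)$, $\mathsf{IncludesCp}=\bigwedge_x(\mathsf{Rg}'_x\to\mathsf{Rg}_x)$; $\mathsf{Stable}=\mathsf{Well}\wedge\bigwedge_x(\mathtt{aw}_x\to(\mathtt{in}_x\leftrightarrow\neg\bigvee_y(\mathtt{in}_y\wedge\mathtt r_{y,x})))$; $\mathsf{Complete}=\mathsf{ConFree}\wedge\bigwedge_x(\mathtt{in}_x\leftrightarrow\bigwedge_y((\mathtt{aw}_y\wedge\mathtt r_{y,x})\to\bigvee_z(\mathtt{in}_z\wedge\mathtt r_{z,y})))$; $\mathsf{Grounded}=\mathsf{Complete}\wedge[\mathsf{mkFalseOne}(\mathsf{IN}_{\mathcal U});\mathsf{mkFalseSome}(\mathsf{IN}_{\mathcal U})]\neg\mathsf{Complete}$; $\mathsf{Preferred}=\mathsf{Admissible}\wedge[\mathsf{mkTrueOne}(\mathsf{IN}_{\mathcal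 U});\mathsf{mkTrueSome}(\mathsf{IN}_{\mathcal U})]\neg\mathsf{Admissible}$; $\mathsf{Naive}=\mathsf{ConFree}\wedge[\mathsf{mkTrueOne}(\mathsf{IN}_{\mathcal U})]\neg\mathsf{ConFree}$; $\mathsf{SemiStable}=\mathsf{Complete}\wedge[\mathsf{copy}(\mathsf{IN}_{\mathcal U});\mathsf{makeExt}^{co}](\mathsf{IncludesCp}\to\mathsf{IncludedInCp})$; $\mathsf{Stage}=\mathsf{ConFree}\wedge[\mathsf{copy}(\mathsf{IN}_{\mathcal U});\mathsf{vary}(\mathsf{IN}_{\mathcal U});\mathsf{ConFree}?](\mathsf{IncludesCp}\to\mathsf{IncludedInCp})$; $\mathsf{IdealSet}=\mathsf{Admissible}\wedge\bigwedge_x(\mathtt{in}_x\to[\mathsf{makeExt}^{pr}]\mathtt{in}_x)$, $\mathsf{EagerSet}=\mathsf{Admissible}\wedge\bigwedge_x(\mathtt{in}_x\to[\mathsf{makeExt}^{se}]\mathtt{in}_x)$; $\mathsf{Ideal}=\mathsf{IdealSet}\wedge[\mathsf{mkTrueOne}(\mathsf{IN}_{\mathcal U});\mathsf{mkTrueSome}(\mathsf{IN}_{\mathcal U})]\neg\mathsf{IdealSet}$; $\mathsf{Eager}=\mathsf{EagerSet}\wedge[\mathsf{mkTrueOne}(\mathsf{IN}_{\mathcal U});\mathsf{mkTrueSome}(\mathsf{IN}_{\mathcal U})]\neg\mathsf{EagerSet}$. **Encoding of CAFs.** For $R=\{(x_1,y_1),\dots,(x_n,y_n)\}$ let $\mathsf{dis}(\mathsf{ATT}_R)=(+\mathtt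 r_{x_1,y_1}\cup+\mathtt r_{y_1,x_1});\dots;(+\mathtt r_{x_n,y_n}\cup+\mathtt r_{y_n,x_n})$. Then $v_{\mathsf{CAF}}=\mathsf{AW}_{A^F}\cup\mathsf{ATT}_{R^F}\cup\mathsf{ATT}_{R^C}$, $\mathsf{control}^{\mathsf{CAF}}=\mathsf{mkTrueSome}(\mathsf{AW}_{A^C})$, and $\mathsf{makeComp}^{\mathsf{CAF}}=\mathsf{mkTrueSome}(\mathsf{AW}_{A^?});\mathsf{mkTrueSome}(\mathsf{ATT}_{R^?});\mathsf{dis}(\mathsf{ATT}_{R^{\leftrightarrow}})$.
   Formalization: With Complete as printed the claim fails for co, gr, se and ea when an argument of 𝒰 is absent from the completion; Complete is corrected so that its biconditional on in_x is required only for x with aw_x. -}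

module Defs where

open import Data.Bool.Base as Bool using (Bool; true; false; T)
open import Data.Bool.Properties using (T?; T-∧; T-∨)
open import Data.Empty using (⊥-elim)
open import Data.Fin.Base using (Fin)
open import Data.Fin.Subset as Subset using (Subset; _∈_; _∉_; _⊆_; _⊂_; _∪_; _∩_)
open import Data.Fin.Subset.Properties using (_∈?_; x∈p∩q⁺; x∈p∩q⁻; x∈p∪q⁻)
open import Data.List.Base
  using (List; []; _∷_; map; filter; foldr; allFin; tabulate; cartesianProduct)
open import Data.Nat.Base using (ℕ)
open import Data.Product.Base using (∃; ∃₂; _×_; _,_; proj₁; proj₂)
open import Data.Sum.Base using (_⊎_; inj₁; inj₂)
open import Data.Vec.Base using (lookup)
open import Data.Vec.Properties using (lookup⇒[]=; []=⇒lookup)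
open import Function.Base using (_∘_)
open import Function.Bundles using (_⇔_; module Equivalence)
open import Level using (0ℓ)
open import Relation.Binary.Core using (Rel)
open import Relation.Binary.Definitions using (Symmetric; Irreflexive)
open import Relation.Binary.PropositionalEquality
  using (_≡_; sym; subst)
open import Relation.Nullary.Negation.Core using (¬_)
open import Relation.Unary as Pred using (Pred; ｛_｝; _≐_)

private
  variable
    n : ℕ

-- The set of all arguments 𝒰 is Fin n.

Attacks : ℕ → Set
Attacks n = Fin n → Fin n → Bool

infix 4 _∈ʳ_ _⊆ʳ_
infixr 6 _∪ʳ_
infix 7 _⊠_ _↾_

_∈ʳ_ : Fin n × Fin n → Attacks n → Set
(x , y) ∈ʳ R = T (R x y)

_⊆ʳ_ : Attacks n → Attacks n → Set
R ⊆ʳ S = ∀ x y → (x , y) ∈ʳ R → (x , y) ∈ʳ S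

_∪ʳ_ : Attacks n → Attacks n → Attacks n
(R ∪ʳ S) x y = R x y Bool.∨ S x y

_⊠_ : Subset n → Subset n → Attacks n
(A ⊠ B) x y = lookup A x Bool.∧ lookup B y

_↾_ : Attacks n → Subset n → Attacks n
(R ↾ A) x y = R x y Bool.∧ (A ⊠ A) x y

Disjoint : Subset n → Subset n → Set
Disjoint A B = Subset.Empty (A ∩ B)

Disjointʳ : Attacks n → Attacks n → Set
Disjointʳ R S = ∀ x y → (x , y) ∈ʳ R → ¬ (x , y) ∈ʳ S

record AF (n : ℕ) : Set where
  field
    A     : Subset n
    R     : Attacks n
    R⊆A×A : R ⊆ʳ A ⊠ A

Maximal : Pred (Subset n) 0ℓ → Pred (Subset n) 0ℓ
Maximal P E = P E × (∀ E′ → P E′ → ¬ (E ⊂ E′))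

Minimal : Pred (Subset n) 0ℓ → Pred (Subset n) 0ℓ
Minimal P E = P E × (∀ E′ → P E′ → ¬ (E′ ⊂ E))

module _ (F : AF n) where
  open AF F

  _⁺ : Subset n → Pred (Fin n) 0ℓ
  (E ⁺) x = x ∈ A × ∃ λ y → y ∈ E × (y , x) ∈ʳ R

  _⊕ : Subset n → Pred (Fin n) 0ℓ
  E ⊕ = (_∈ E) Pred.∪ (E ⁺)

  -- The standing assumption E ⊆ A is part of this definition, and all
  -- the notions below inherit it from here.
  IsConflictFree : Pred (Subset n) 0ℓ
  IsConflictFree E = E ⊆ A × Pred.Empty ((_∈ E) Pred.∩ (E ⁺))

  Defends : Subset n → Pred (Fin n) 0ℓ
  Defends E a = ∀ x → x ∈ A → (x , a) ∈ʳ R → (E ⁺) x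

  IsAdmissible : Pred (Subset n) 0ℓ
  IsAdmissible E = IsConflictFree E × (∀ a → a ∈ E → Defends E a)

  IsStable : Pred (Subset n) 0ℓ
  IsStable E = IsConflictFree E × (∀ x → x ∈ A → x ∉ E → (E ⁺) x)

  IsComplete : Pred (Subset n) 0ℓ
  IsComplete E = IsConflictFree E × (∀ a → a ∈ A → a ∈ E ⇔ Defends E a)

  IsGrounded : Pred (Subset n) 0ℓ
  IsGrounded = Minimal IsComplete

  IsPreferred : Pred (Subset n) 0ℓ
  IsPreferred = Maximal IsComplete

  IsSemiStable : Pred (Subset n) 0ℓ
  IsSemiStable E =
    IsComplete E × (∀ E′ → IsComplete E′ → ¬ ((E ⊕) Pred.⊂ (E′ ⊕)))

  IsIdealSet : Pred (Subset n) 0ℓ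
  IsIdealSet E = IsAdmissible E × (∀ E′ → IsPreferred E′ → E ⊆ E′)

  IsIdeal : Pred (Subset n) 0ℓ
  IsIdeal = Maximal IsIdealSet

  IsEagerSet : Pred (Subset n) 0ℓ
  IsEagerSet E = IsAdmissible E × (∀ E′ → IsSemiStable E′ → E ⊆ E′)

  IsEager : Pred (Subset n) 0ℓ
  IsEager = Maximal IsEagerSet

  IsNaive : Pred (Subset n) 0ℓ
  IsNaive = Maximal IsConflictFree

  IsStage : Pred (Subset n) 0ℓ
  IsStage E =
    IsConflictFree E × (∀ E′ → IsConflictFree E′ → ¬ ((E ⊕) Pred.⊂ (E′ ⊕)))

data Semantics : Set where
  st co gr pr se id′ ea na stg : Semantics

Extension : Semantics → AF n → Pred (Subset n) 0ℓ
Extension st  = IsStable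
Extension co  = IsComplete
Extension gr  = IsGrounded
Extension pr  = IsPreferred
Extension se  = IsSemiStable
Extension id′ = IsIdeal
Extension ea  = IsEager
Extension na  = IsNaive
Extension stg = IsStage

record CAF (n : ℕ) : Set where
  field
    Aᶠ A? Aᶜ    : Subset n
    Rᶠ R? R↔ Rᶜ : Attacks n

    Aᶠ-A? : Disjoint Aᶠ A?
    Aᶠ-Aᶜ : Disjoint Aᶠ Aᶜ
    A?-Aᶜ : Disjoint A? Aᶜ

    Rᶠ⊆ : Rᶠ ⊆ʳ (Aᶠ ∪ A?) ⊠ (Aᶠ ∪ A?)
    R?⊆ : R? ⊆ʳ (Aᶠ ∪ A?) ⊠ (Aᶠ ∪ A?)
    R↔⊆ : R↔ ⊆ʳ (Aᶠ ∪ A?) ⊠ (Aᶠ ∪ A?)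
    Rᶜ⊆ : Rᶜ ⊆ʳ Aᶜ ⊠ (Aᶠ ∪ A? ∪ Aᶜ) ∪ʳ (Aᶠ ∪ A? ∪ Aᶜ) ⊠ Aᶜ

    R↔-sym    : Symmetric (λ x y → (x , y) ∈ʳ R↔)
    R↔-irrefl : Irreflexive _≡_ (λ x y → (x , y) ∈ʳ R↔)

    Rᶠ-R? : Disjointʳ Rᶠ R?
    Rᶠ-R↔ : Disjointʳ Rᶠ R↔
    Rᶠ-Rᶜ : Disjointʳ Rᶠ Rᶜ
    R?-R↔ : Disjointʳ R? R↔
    R?-Rᶜ : Disjointʳ R? Rᶜ
    R↔-Rᶜ : Disjointʳ R↔ Rᶜ

record Completion (caf : CAF n) (F : AF n) : Set where
  open CAF caf
  open AF F renaming (A to A*; R to R*)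
  field
    A-lower : Aᶠ ∪ Aᶜ ⊆ A*
    A-upper : A* ⊆ Aᶠ ∪ Aᶜ ∪ A?
    R-lower : (Rᶠ ∪ʳ Rᶜ) ↾ A* ⊆ʳ R*
    R-upper : R* ⊆ʳ (Rᶠ ∪ʳ Rᶜ ∪ʳ R? ∪ʳ R↔) ↾ A*
    R↔-some : ∀ x y → x ∈ A* → y ∈ A* → (x , y) ∈ʳ R↔ →
              (x , y) ∈ʳ R* ⊎ (y , x) ∈ʳ R*

module _ (caf : CAF n) (CFG : Subset n) (CFG⊆Aᶜ : CFG ⊆ CAF.Aᶜ caf) where
  open CAF caf
  open Equivalence using (to; from)

  private
    V : Subset n
    V = Aᶠ ∪ A? ∪ CFG

    Rᶜ↾V⊆Rᶜ : Rᶜ ↾ V ⊆ʳ Rᶜ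
    Rᶜ↾V⊆Rᶜ x y = proj₁ ∘ to T-∧

    disjoint : ∀ {A} → Disjoint A Aᶜ → Disjoint A CFG
    disjoint {A} A∩Aᶜ=∅ (x , x∈) with x∈p∩q⁻ A CFG x∈
    ... | x∈A , x∈CFG = A∩Aᶜ=∅ (x , x∈p∩q⁺ (x∈A , CFG⊆Aᶜ x∈CFG))

    T⇒∈ : ∀ A {x : Fin n} → T (lookup A x) → x ∈ A
    T⇒∈ A {x} t with lookup A x in eq
    ... | true = lookup⇒[]= x A eq

    ∈⇒T : ∀ A {x : Fin n} → x ∈ A → T (lookup A x)
    ∈⇒T A x∈A = subst T (sym ([]=⇒lookup x∈A)) _

    V∩Aᶜ⊆CFG : ∀ {x} → x ∈ V → x ∈ Aᶜ → x ∈ CFG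
    V∩Aᶜ⊆CFG {x} x∈V x∈Aᶜ with x∈p∪q⁻ Aᶠ (A? ∪ CFG) x∈V
    ... | inj₁ x∈Aᶠ = ⊥-elim (Aᶠ-Aᶜ (x , x∈p∩q⁺ (x∈Aᶠ , x∈Aᶜ)))
    ... | inj₂ x∈ with x∈p∪q⁻ A? CFG x∈
    ...   | inj₁ x∈A?  = ⊥-elim (A?-Aᶜ (x , x∈p∩q⁺ (x∈A? , x∈Aᶜ)))
    ...   | inj₂ x∈CFG = x∈CFG

    narrow : ∀ {x} → T (lookup V x) → T (lookup Aᶜ x) → T (lookup CFG x)
    narrow x∈V x∈Aᶜ = ∈⇒T CFG (V∩Aᶜ⊆CFG (T⇒∈ V x∈V) (T⇒∈ Aᶜ x∈Aᶜ))

    Rᶜ↾V⊆ : Rᶜ ↾ V ⊆ʳ CFG ⊠ V ∪ʳ V ⊠ CFG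
    Rᶜ↾V⊆ x y xy with to T-∧ xy
    ... | xy∈Rᶜ , xy∈V with to T-∧ xy∈V | to T-∨ (Rᶜ⊆ x y xy∈Rᶜ)
    ...   | x∈V , y∈V | inj₁ l =
            from T-∨ (inj₁ (from T-∧ (narrow x∈V (proj₁ (to T-∧ l)) , y∈V)))
    ...   | x∈V , y∈V | inj₂ l =
            from T-∨ (inj₂ (from T-∧ (x∈V , narrow y∈V (proj₂ (to T-∧ l)))))

  configure : CAF n
  configure = record
    { Aᶠ = Aᶠ ; A? = A? ; Aᶜ = CFG
    ; Rᶠ = Rᶠ ; R? = R? ; R↔ = R↔ ; Rᶜ = Rᶜ ↾ (Aᶠ ∪ A? ∪ CFG)
    ; Aᶠ-A? = Aᶠ-A?
    ; Aᶠ-Aᶜ = disjoint Aᶠ-Aᶜ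
    ; A?-Aᶜ = disjoint A?-Aᶜ
    ; Rᶠ⊆ = Rᶠ⊆ ; R?⊆ = R?⊆ ; R↔⊆ = R↔⊆ ; Rᶜ⊆ = Rᶜ↾V⊆
    ; R↔-sym = λ {x} {y} → R↔-sym {x} {y}
    ; R↔-irrefl = R↔-irrefl
    ; Rᶠ-R? = Rᶠ-R?
    ; Rᶠ-R↔ = Rᶠ-R↔
    ; Rᶠ-Rᶜ = λ x y p q → Rᶠ-Rᶜ x y p (Rᶜ↾V⊆Rᶜ x y q)
    ; R?-R↔ = R?-R↔
    ; R?-Rᶜ = λ x y p q → R?-Rᶜ x y p (Rᶜ↾V⊆Rᶜ x y q)
    ; R↔-Rᶜ = λ x y p q → R↔-Rᶜ x y p (Rᶜ↾V⊆Rᶜ x y q)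
    }

module _ (σ : Semantics) (caf : CAF n) (a : Fin n) where
  open CAF caf using (Aᶜ)

  NSCon : Set
  NSCon = ∃₂ λ CFG (CFG⊆Aᶜ : CFG ⊆ Aᶜ) →
    ∀ F → Completion (configure caf CFG CFG⊆Aᶜ) F →
    ∀ E → Extension σ F E → a ∈ E

  NCCon : Set
  NCCon = ∃₂ λ CFG (CFG⊆Aᶜ : CFG ⊆ Aᶜ) →
    ∀ F → Completion (configure caf CFG CFG⊆Aᶜ) F →
    ∃ λ E → Extension σ F E × a ∈ E

  PCCon : Set
  PCCon = ∃₂ λ CFG (CFG⊆Aᶜ : CFG ⊆ Aᶜ) →
    ∃ λ F → Completion (configure caf CFG CFG⊆Aᶜ) F ×
    ∃ λ E → Extension σ F E × a ∈ E

  PSCon : Set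
  PSCon = ∃₂ λ CFG (CFG⊆Aᶜ : CFG ⊆ Aᶜ) →
    ∃ λ F → Completion (configure caf CFG CFG⊆Aᶜ) F ×
    (∀ E → Extension σ F E → a ∈ E)

-- "inn x" is the variable in_x ("in" is a keyword); the variables
-- "other k" make the set countably infinite.
data Prp (n : ℕ) : Set where
  aw inn inn′ : Fin n → Prp n
  r           : Fin n → Fin n → Prp n
  other       : ℕ → Prp n

infix  9 _⁻¹
infix  8 ∼_ +_ -_
infixr 7 _∧_
infixr 6 _∨_
infixr 5 _⇒_
infix  4 _↔_
infixr 4 _⨾_
infixr 3 _⋓_
infixr 8 [_]_ ⟨_⟩_

mutual
  data Formula (n : ℕ) : Set where
    var  : Prp n → Formula n
    ∼_   : Formula n → Formula n
    _∧_  : Formula n → Formula n → Formula n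
    [_]_ : Program n → Formula n → Formula n

  data Program (n : ℕ) : Set where
    +_ -_ : Prp n → Program n
    test  : Formula n → Program n
    _⨾_   : Program n → Program n → Program n
    _⋓_   : Program n → Program n → Program n
    _⁻¹   : Program n → Program n

Valuation : ℕ → Set
Valuation n = Prp n → Bool

⌊_⌋ : Valuation n → Pred (Prp n) 0ℓ
⌊ v ⌋ p = T (v p)

infix 2 _⊨_

mutual
  _⊨_ : Valuation n → Formula n → Set
  v ⊨ var p     = ⌊ v ⌋ p
  v ⊨ ∼ φ       = ¬ (v ⊨ φ)
  v ⊨ φ ∧ ψ     = (v ⊨ φ) × (v ⊨ ψ)
  v ⊨ [ π ] φ   = ∀ v′ → ⟦ π ⟧ v v′ → v′ ⊨ φ

  -- Equality of valuations is equality as sets of variables.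
  ⟦_⟧ : Program n → Rel (Valuation n) 0ℓ
  ⟦ + p ⟧    v v′ = ⌊ v′ ⌋ ≐ ⌊ v ⌋ Pred.∪ ｛ p ｝
  ⟦ - p ⟧    v v′ = ⌊ v′ ⌋ ≐ ⌊ v ⌋ Pred.∖ ｛ p ｝
  ⟦ test φ ⟧ v v′ = ⌊ v′ ⌋ ≐ ⌊ v ⌋ × (v ⊨ φ)
  ⟦ π ⨾ ρ ⟧  v v′ = ∃ λ w → ⟦ π ⟧ v w × ⟦ ρ ⟧ w v′
  ⟦ π ⋓ ρ ⟧  v v′ = ⟦ π ⟧ v v′ ⊎ ⟦ ρ ⟧ v v′
  ⟦ π ⁻¹ ⟧   v v′ = ⟦ π ⟧ v′ v

⟨_⟩_ : Program n → Formula n → Formula n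
⟨ π ⟩ φ = ∼ [ π ] ∼ φ

_∨_ _⇒_ _↔_ : Formula n → Formula n → Formula n
φ ∨ ψ = ∼ (∼ φ ∧ ∼ ψ)
φ ⇒ ψ = ∼ (φ ∧ ∼ ψ)
φ ↔ ψ = (φ ⇒ ψ) ∧ (ψ ⇒ φ)

⊤ ⊥ : Formula n
⊤ = ∼ (var (other 0) ∧ ∼ var (other 0))
⊥ = ∼ ⊤

⋀ ⋁ : (Fin n → Formula n) → Formula n
⋀ φ = foldr _∧_ ⊤ (tabulate φ)
⋁ φ = foldr _∨_ ⊥ (tabulate φ)

skip : Program n
skip = test ⊤

sequence : List (Program n) → Program n
sequence = foldr _⨾_ skip

-- Only the empty union is skip, so skip must not be a base case for
-- non-empty unions.
union : List (Program n) → Program n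
union []           = skip
union (π ∷ [])     = π
union (π ∷ ρ ∷ πs) = π ⋓ union (ρ ∷ πs)

mkTrueOne mkFalseOne mkTrueSome mkFalseSome vary : List (Prp n) → Program n
mkTrueOne   P = union (map (λ p → test (∼ var p) ⨾ + p) P)
mkFalseOne  P = union (map (λ p → test (var p) ⨾ - p) P)
mkTrueSome  P = sequence (map (λ p → + p ⋓ skip) P)
mkFalseSome P = sequence (map (λ p → - p ⋓ skip) P)
vary        P = sequence (map (λ p → + p ⋓ - p) P)

IN : List (Prp n)
IN = map inn (allFin _)

Well ConFree Admissible Stable Complete : Formula n

Well = ⋀ λ x → var (inn x) ⇒ var (aw x)

ConFree = Well ∧ ⋀ λ x → ⋀ λ y → ∼ (var (inn x) ∧ var (inn y) ∧ var (r x y))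

Defended : Fin n → Formula n
Defended x = ⋀ λ y → var (aw y) ∧ var (r y x) ⇒ ⋁ λ z → var (inn z) ∧ var (r z y)

Admissible = ConFree ∧ ⋀ λ x → var (inn x) ⇒ Defended x

Stable = Well ∧ ⋀ λ x →
  var (aw x) ⇒ (var (inn x) ↔ ∼ ⋁ λ y → var (inn y) ∧ var (r y x))

-- The guard aw_x is essential: an x ∈ 𝒰 outside the current framework
-- that has no attackers satisfies Defended x vacuously, so an unguarded
-- biconditional would force in_x and contradict Well.
Complete = ConFree ∧ ⋀ λ x → var (aw x) ⇒ (var (inn x) ↔ Defended x)

copyIN : Program n
copyIN = sequence (tabulate λ x →
  (test (var (inn x)) ⨾ + inn′ x) ⋓ (test (∼ var (inn x)) ⨾ - inn′ x))

Rg Rg′ : Fin n → Formula n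
Rg  x = var (inn  x) ∨ (var (aw x) ∧ ⋁ λ y → var (inn  y) ∧ var (r y x))
Rg′ x = var (inn′ x) ∨ (var (aw x) ∧ ⋁ λ y → var (inn′ y) ∧ var (r y x))

IncludedInCp IncludesCp : Formula n
IncludedInCp = ⋀ λ x → Rg x ⇒ Rg′ x
IncludesCp   = ⋀ λ x → Rg′ x ⇒ Rg x

strictlySmaller strictlyLarger : Program n
strictlySmaller = mkFalseOne IN ⨾ mkFalseSome IN
strictlyLarger  = mkTrueOne IN ⨾ mkTrueSome IN

makeExtOf : Formula n → Program n
makeExtOf φ = vary IN ⨾ test φ

Grounded Preferred Naive SemiStable Stage : Formula n

Grounded   = Complete ∧ [ strictlySmaller ] ∼ Complete
Preferred  = Admissible ∧ [ strictlyLarger ] ∼ Admissible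
Naive      = ConFree ∧ [ mkTrueOne IN ] ∼ ConFree
SemiStable = Complete ∧
  [ copyIN ⨾ makeExtOf Complete ] (IncludesCp ⇒ IncludedInCp)
Stage      = ConFree ∧
  [ copyIN ⨾ vary IN ⨾ test ConFree ] (IncludesCp ⇒ IncludedInCp)

IdealSet EagerSet Ideal Eager : Formula n

IdealSet = Admissible ∧
  ⋀ λ x → var (inn x) ⇒ [ makeExtOf Preferred ] var (inn x)
EagerSet = Admissible ∧
  ⋀ λ x → var (inn x) ⇒ [ makeExtOf SemiStable ] var (inn x)
Ideal    = IdealSet ∧ [ strictlyLarger ] ∼ IdealSet
Eager    = EagerSet ∧ [ strictlyLarger ] ∼ EagerSet

extensionFormula : Semantics → Formula n
extensionFormula st  = Stable
extensionFormula co  = Complete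
extensionFormula gr  = Grounded
extensionFormula pr  = Preferred
extensionFormula se  = SemiStable
extensionFormula id′ = Ideal
extensionFormula ea  = Eager
extensionFormula na  = Naive
extensionFormula stg = Stage

makeExt : Semantics → Program n
makeExt σ = makeExtOf (extensionFormula σ)

AW : Subset n → List (Prp n)
AW A = map aw (filter (_∈? A) (allFin _))

pairs : Attacks n → List (Fin n × Fin n)
pairs R = filter (λ (x , y) → T? (R x y)) (cartesianProduct (allFin _) (allFin _))

ATT : Attacks n → List (Prp n)
ATT R = map (λ (x , y) → r x y) (pairs R)

dis : Attacks n → Program n
dis R = sequence (map (λ (x , y) → + r x y ⋓ + r y x) (pairs R))

module _ (caf : CAF n) where
  open CAF caf

  valuation : Valuation n
  valuation (aw x)    = lookup Aᶠ x
  valuation (r x y)   = (Rᶠ ∪ʳ Rᶜ) x y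
  valuation (inn x)   = false
  valuation (inn′ x)  = false
  valuation (other k) = false

  control : Program n
  control = mkTrueSome (AW Aᶜ)

  makeComp : Program n
  makeComp = mkTrueSome (AW A?) ⨾ mkTrueSome (ATT R?) ⨾ dis R↔

{-# OPTIONS --safe #-}
module Submission where

-- A DL-PA program only touches the finitely many variables it mentions, so
-- truth is decidable: this turns ⟨ π ⟩ φ = ∼ [ π ] ∼ φ into the existence of
-- an actual π-successor.  Each formula φ_σ holds at a valuation encoding a
-- framework F and a set E exactly when E is a σ-extension of F; for preferred
-- extensions this uses that maximal admissible and maximal complete sets
-- coincide.  The control program reaches exactly the control configurations and
-- makeComp exactly the completions, up to attacks involving absent arguments.
-- The four equivalences follow by composing the quantifiers.

open import Data.Bool.Base as Bool using (Bool; true; false; T; if_then_else_)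
open import Data.Bool.Properties as Bool using (T-≡; T-∧; T-∨; T-not-≡; ⇔→≡)
open import Data.Fin.Base using (Fin; zero; suc)
open import Data.Fin.Properties as Fin using ()
open import Data.Fin.Subset as Subset
  using (Subset; _∈_; _∉_; _⊆_; _⊂_; _∪_; _∩_; ⁅_⁆)
open import Data.Fin.Subset.Induction using (⊃-wellFounded)
open import Data.Fin.Subset.Properties
  using (_∈?_; x∈p∪q⁻; x∈p∪q⁺; x∈p∩q⁺; x∈p∩q⁻; x∈⁅x⁆; x∈⁅y⁆⇒x≡y; ⊂-⊆-trans; p⊆p∪q; p∩q⊆q)
open import Data.List.Base as List
  using (List; []; _∷_; _++_; map; allFin; foldr; tabulate)
open import Data.List.Membership.Propositional
  using (find; lose) renaming (_∈_ to _∈ˡ_; _∉_ to _∉ˡ_)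
open import Data.List.Membership.Propositional.Properties
  using (∈-++⁺ˡ; ∈-++⁺ʳ; ∈-map⁺; ∈-map⁻; ∈-filter⁺; ∈-filter⁻; ∈-allFin; ∈-cartesianProduct⁺)
open import Data.List.Properties using (map-tabulate)
open import Data.List.Relation.Unary.All as All using (all?)
open import Data.List.Relation.Unary.Any using (Any; here; there)
open import Data.List.Relation.Unary.Any.Properties using (map⁻)
open import Data.Nat.Base using (ℕ; NonZero)
open import Data.Nat.Properties as ℕ using ()
open import Data.Product.Base as Product using (∃; ∃₂; _×_; _,_; proj₁; proj₂)
open import Data.Product.Function.NonDependent.Propositional using (_×-⇔_)
open import Data.Product.Properties as Product using ()
open import Data.Sum.Base as Sum using (_⊎_; inj₁; inj₂)
open import Data.Sum.Function.Propositional using (_⊎-⇔_)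
open import Data.Sum.Properties as Sum using ()
open import Data.Unit.Base using (tt) renaming (⊤ to Unit)
open import Data.Vec.Base as Vec using (lookup)
open import Data.Vec.Properties using (lookup⇒[]=; []=⇒lookup; lookup∘tabulate)
open import Function.Base using (_∘_; id; case_of_)
open import Function.Bundles using (_⇔_; mk⇔; module Equivalence)
open import Function.Construct.Composition using (_⇔-∘_)
open import Function.Construct.Identity using (⇔-id)
open import Function.Construct.Symmetry using (⇔-sym)
open import Function.Related.TypeIsomorphisms using (¬-cong-⇔)
open import Induction.WellFounded using (Acc; acc)
open import Level using (0ℓ)
open import Relation.Binary.Core using (Rel)
open import Relation.Binary.Definitions using (DecidableEquality; Symmetric; Transitive)
open import Relation.Binary.PropositionalEquality
  using (_≡_; _≢_; refl; sym; trans; cong; subst)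
open import Relation.Nullary.Decidable
  using (Dec; yes; no; does; map′; ¬?; _×-dec_; _⊎-dec_; decidable-stable; dec-true; dec-false)
open import Relation.Nullary.Negation.Core using (¬_; contradiction)
open import Relation.Unary as Pred using (Pred; ｛_｝; _≐_)
open import Relation.Unary.Properties using (≐-sym; ≐-trans)
open import Defs

open Equivalence using (to; from)

-- A diamond is by definition only a doubly negated existence, so constructively its witness has to
-- be found by search. That is not immediate: valuations are Boolean functions on infinitely many
-- variables, and programs determine their results only up to equality as sets. Hence everything is
-- stated up to `≈`, and relations are decided only between valuations already known to agree off a
-- finite list. The second obstacle is that a valuation carries more than a framework: attack
-- variables may be on at arguments that are absent. Once a set is known to lie inside the
-- framework, the formulas depend on `r x y` only for present `x` and `y`. Many valuations therefore
-- encode one framework, and each acceptance statement is shown for all of them at once.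

private
  variable
    n : ℕ
    I : Set
    p : Prp n
    P : List (Prp n)
    u v v′ w w′ : Valuation n
    E E′ : Subset n

-- Decidability of DL-PA

module _ {n : ℕ} where
  private
    Code : Set
    Code = Fin n ⊎ Fin n ⊎ Fin n ⊎ (Fin n × Fin n) ⊎ ℕ

    encode : Prp n → Code
    encode (aw x)    = inj₁ x
    encode (inn x)   = inj₂ (inj₁ x)
    encode (inn′ x)  = inj₂ (inj₂ (inj₁ x))
    encode (r x y)   = inj₂ (inj₂ (inj₂ (inj₁ (x , y))))
    encode (other k) = inj₂ (inj₂ (inj₂ (inj₂ k)))

    decode : Code → Prp n
    decode (inj₁ x)                             = aw x
    decode (inj₂ (inj₁ x))                      = inn x
    decode (inj₂ (inj₂ (inj₁ x)))               = inn′ x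
    decode (inj₂ (inj₂ (inj₂ (inj₁ (x , y)))))  = r x y
    decode (inj₂ (inj₂ (inj₂ (inj₂ k))))        = other k

    decode-encode : ∀ p → decode (encode p) ≡ p
    decode-encode (aw x)    = refl
    decode-encode (inn x)   = refl
    decode-encode (inn′ x)  = refl
    decode-encode (r x y)   = refl
    decode-encode (other k) = refl

    encode-injective : ∀ {p q} → encode p ≡ encode q → p ≡ q
    encode-injective {p} {q} eq =
      trans (sym (decode-encode p)) (trans (cong decode eq) (decode-encode q))

    _≟ᶜ_ : DecidableEquality Code
    _≟ᶜ_ = Sum.≡-dec Fin._≟_ (Sum.≡-dec Fin._≟_ (Sum.≡-dec Fin._≟_
             (Sum.≡-dec (Product.≡-dec Fin._≟_ Fin._≟_) ℕ._≟_)))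

  infix 4 _≟_

  -- Opaque: an unfolded p ≟ q is no longer recognised by with-abstraction.
  abstract
    _≟_ : DecidableEquality (Prp n)
    p ≟ q = map′ encode-injective (cong encode) (encode p ≟ᶜ encode q)

infix 4 _≈_

_≈_ : Rel (Valuation n) 0ℓ
v ≈ w = ∀ p → v p ≡ w p

≈-refl : v ≈ v
≈-refl p = refl

≈-sym : v ≈ w → w ≈ v
≈-sym v≈w p = sym (v≈w p)

≈-trans : u ≈ v → v ≈ w → u ≈ w
≈-trans u≈v v≈w p = trans (u≈v p) (v≈w p)

T-injective : ∀ {b c} → T b ⇔ T c → b ≡ c
T-injective b⇔c =
  ⇔→≡ (mk⇔ (to T-≡ ∘ to b⇔c ∘ from T-≡) (to T-≡ ∘ from b⇔c ∘ from T-≡))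

≐⇒≈ : ⌊ v ⌋ ≐ ⌊ w ⌋ → v ≈ w
≐⇒≈ (v⊆w , w⊆v) p = T-injective (mk⇔ v⊆w w⊆v)

≈⇒≐ : v ≈ w → ⌊ v ⌋ ≐ ⌊ w ⌋
≈⇒≐ v≈w = (λ {p} → subst T (v≈w p)) , (λ {p} → subst T (sym (v≈w p)))

update : Prp n → Bool → Valuation n → Valuation n
update p b v q = if does (p ≟ q) then b else v q

update-≡ : ∀ (p : Prp n) b v → update p b v p ≡ b
update-≡ p b v rewrite dec-true (p ≟ p) refl = refl

update-≢ : ∀ {p q : Prp n} b v → p ≢ q → update p b v q ≡ v q
update-≢ {p = p} {q} b v p≢q rewrite dec-false (p ≟ q) p≢q = refl

update-unique : ∀ (p : Prp n) {b v w} →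
                w p ≡ b → (∀ q → p ≢ q → w q ≡ v q) → w ≈ update p b v
update-unique p {b} {v} wp≡b w≡v q with p ≟ q
... | yes refl = wp≡b
... | no  p≢q  = w≡v q p≢q

update-cong : ∀ (p : Prp n) b → v ≈ w → update p b v ≈ update p b w
update-cong p b v≈w q with p ≟ q
... | yes _ = refl
... | no  _ = v≈w q

-- The Boolean treats the true and false variants of `mkOne` and `mkSome` together: `mkTrueOne`,
-- `mkFalseOne`, `mkTrueSome` and `mkFalseSome` are instances by computation.
assign : Bool → Prp n → Program n
assign true  p = + p
assign false p = - p

literal : Bool → Prp n → Formula n
literal true  p = var p
literal false p = ∼ var p

⊨-literal : ∀ b (p : Prp n) v → (v ⊨ literal b p) ⇔ v p ≡ b
⊨-literal true  p v = T-≡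
⊨-literal false p v with v p
... | true  = mk⇔ (λ ¬t → contradiction _ ¬t) (λ ())
... | false = mk⇔ (λ _ → refl) (λ _ ())

⌊update⌋ : ∀ b (p : Prp n) v w →
           ⟦ assign b p ⟧ v w ⇔ (⌊ w ⌋ ≐ ⌊ update p b v ⌋)
⌊update⌋ true p v w = mk⇔ (λ e → ≐-trans e v∪p≐) (λ e → ≐-trans e (≐-sym v∪p≐))
  where
  v∪p≐ : ⌊ v ⌋ Pred.∪ ｛ p ｝ ≐ ⌊ update p true v ⌋
  v∪p≐ = (λ {q} → ⊆ q) , (λ {q} → ⊇ q)
    where
    ⊆ : ∀ q → (⌊ v ⌋ Pred.∪ ｛ p ｝) q → T (update p true v q)
    ⊆ q q∈ with p ≟ q
    ⊆ q q∈         | yes _  = _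
    ⊆ q (inj₁ q∈v) | no _   = q∈v
    ⊆ q (inj₂ p≡q) | no p≢q = contradiction p≡q p≢q

    ⊇ : ∀ q → T (update p true v q) → (⌊ v ⌋ Pred.∪ ｛ p ｝) q
    ⊇ q q∈ with p ≟ q
    ... | yes p≡q = inj₂ p≡q
    ... | no  _   = inj₁ q∈
⌊update⌋ false p v w = mk⇔ (λ e → ≐-trans e v∖p≐) (λ e → ≐-trans e (≐-sym v∖p≐))
  where
  v∖p≐ : ⌊ v ⌋ Pred.∖ ｛ p ｝ ≐ ⌊ update p false v ⌋
  v∖p≐ = (λ {q} → ⊆ q) , (λ {q} → ⊇ q)
    where
    ⊆ : ∀ q → (⌊ v ⌋ Pred.∖ ｛ p ｝) q → T (update p false v q)
    ⊆ q (q∈v , p≢q) with p ≟ q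
    ... | yes p≡q = contradiction p≡q p≢q
    ... | no  _   = q∈v

    ⊇ : ∀ q → T (update p false v q) → (⌊ v ⌋ Pred.∖ ｛ p ｝) q
    ⊇ q q∈ with p ≟ q
    ... | no p≢q = q∈ , p≢q

⟦assign⟧ : ∀ b (p : Prp n) v w → ⟦ assign b p ⟧ v w ⇔ w ≈ update p b v
⟦assign⟧ b p v w = mk⇔ ≐⇒≈ ≈⇒≐ ⇔-∘ ⌊update⌋ b p v w

mutual
  -- Simultaneous with the statement on programs, since a box contains a program and a test contains
  -- a formula.
  ⊨-resp-≈ : ∀ φ → v ≈ w → v ⊨ φ → w ⊨ φ
  ⊨-resp-≈ (var p)   v≈w v⊨ = subst T (v≈w p) v⊨
  ⊨-resp-≈ (∼ φ)     v≈w v⊭ = v⊭ ∘ ⊨-resp-≈ φ (≈-sym v≈w)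
  ⊨-resp-≈ (φ ∧ ψ)   v≈w    = Product.map (⊨-resp-≈ φ v≈w) (⊨-resp-≈ ψ v≈w)
  ⊨-resp-≈ ([ π ] φ) v≈w v⊨ u = v⊨ u ∘ ⟦⟧-resp-≈ π (≈-sym v≈w) ≈-refl

  ⟦⟧-resp-≈ : ∀ π → v ≈ v′ → w ≈ w′ → ⟦ π ⟧ v w → ⟦ π ⟧ v′ w′
  ⟦⟧-resp-≈ {v = v} {v′} {w} {w′} (+ p) v≈v′ w≈w′ = from (⟦assign⟧ true p v′ w′) ∘
    (λ e → ≈-trans (≈-sym w≈w′) (≈-trans e (update-cong p true v≈v′))) ∘ to (⟦assign⟧ true p v w)
  ⟦⟧-resp-≈ {v = v} {v′} {w} {w′} (- p) v≈v′ w≈w′ = from (⟦assign⟧ false p v′ w′) ∘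
    (λ e → ≈-trans (≈-sym w≈w′) (≈-trans e (update-cong p false v≈v′))) ∘ to (⟦assign⟧ false p v w)
  ⟦⟧-resp-≈ (test φ) v≈v′ w≈w′ (w≐v , v⊨φ) =
    ≈⇒≐ (≈-trans (≈-sym w≈w′) (≈-trans (≐⇒≈ w≐v) v≈v′)) , ⊨-resp-≈ φ v≈v′ v⊨φ
  ⟦⟧-resp-≈ (π ⨾ ρ) v≈v′ w≈w′ (u , vπu , uρw) =
    u , ⟦⟧-resp-≈ π v≈v′ ≈-refl vπu , ⟦⟧-resp-≈ ρ ≈-refl w≈w′ uρw
  ⟦⟧-resp-≈ (π ⋓ ρ) v≈v′ w≈w′ = Sum.map (⟦⟧-resp-≈ π v≈v′ w≈w′) (⟦⟧-resp-≈ ρ v≈v′ w≈w′)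
  ⟦⟧-resp-≈ (π ⁻¹)  v≈v′ w≈w′ = ⟦⟧-resp-≈ π w≈w′ v≈v′

Agree : List (Prp n) → Rel (Valuation n) 0ℓ
Agree P v w = ∀ p → p ∉ˡ P → v p ≡ w p

Agree-sym : Agree P v w → Agree P w v
Agree-sym v~w p p∉P = sym (v~w p p∉P)

Agree-trans : Agree P u v → Agree P v w → Agree P u w
Agree-trans u~v v~w p p∉P = trans (u~v p p∉P) (v~w p p∉P)

Agree-++ˡ : ∀ {Q} → Agree P v w → Agree (P ++ Q) v w
Agree-++ˡ v~w p p∉ = v~w p (p∉ ∘ ∈-++⁺ˡ)

Agree-++ʳ : ∀ {Q} → Agree P v w → Agree (Q ++ P) v w
Agree-++ʳ {Q = Q} v~w p p∉ = v~w p (p∉ ∘ ∈-++⁺ʳ Q)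

Agree-∷ : Agree P v w → Agree (p ∷ P) v w
Agree-∷ v~w p p∉ = v~w p (p∉ ∘ there)

Agree-update : ∀ {p : Prp n} {b v} → p ∈ˡ P → Agree P v (update p b v)
Agree-update {P = P} {b = b} {v} p∈P q q∉P = sym (update-≢ b v (λ { refl → q∉P p∈P }))

-- Only assigned variables count. A test reads variables but changes none, so it contributes
-- nothing; agreement is symmetric, so the converse adds nothing either.
vars : Program n → List (Prp n)
vars (+ p)    = p ∷ []
vars (- p)    = p ∷ []
vars (test φ) = []
vars (π ⨾ ρ)  = vars π ++ vars ρ
vars (π ⋓ ρ)  = vars π ++ vars ρ
vars (π ⁻¹)   = vars π

⟦⟧⇒Agree : ∀ π → ⟦ π ⟧ v w → Agree (vars π) v w
⟦⟧⇒Agree {v = v} {w} (+ p) vw q q∉ =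
  sym (trans (to (⟦assign⟧ true p v w) vw q) (update-≢ true v (λ { refl → q∉ (here refl) })))
⟦⟧⇒Agree {v = v} {w} (- p) vw q q∉ =
  sym (trans (to (⟦assign⟧ false p v w) vw q) (update-≢ false v (λ { refl → q∉ (here refl) })))
⟦⟧⇒Agree (test φ) (w≐v , _) q _ = sym (≐⇒≈ w≐v q)
⟦⟧⇒Agree (π ⨾ ρ) (_ , vπu , uρw) =
  Agree-trans (Agree-++ˡ (⟦⟧⇒Agree π vπu)) (Agree-++ʳ {Q = vars π} (⟦⟧⇒Agree ρ uρw))
⟦⟧⇒Agree (π ⋓ ρ) (inj₁ vπw) = Agree-++ˡ (⟦⟧⇒Agree π vπw)
⟦⟧⇒Agree (π ⋓ ρ) (inj₂ vρw) = Agree-++ʳ {Q = vars π} (⟦⟧⇒Agree ρ vρw)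
⟦⟧⇒Agree (π ⁻¹) wπv = Agree-sym (⟦⟧⇒Agree π wπv)

module _ {n : ℕ} where
  open import Data.List.Membership.DecPropositional (_≟_ {n}) public
    using () renaming (_∈?_ to _∈ˡ?_)

-- Comparing two arbitrary valuations would take infinitely many checks; agreement off `P` leaves
-- only the members of `P`.
≈-dec : ∀ P (v w : Valuation n) → Agree P v w → Dec (v ≈ w)
≈-dec P v w v~w = map′ ≈⁺ (λ v≈w → All.tabulate (λ {p} _ → v≈w p)) (all? (λ p → v p Bool.≟ w p) P)
  where
  ≈⁺ : All.All (λ p → v p ≡ w p) P → v ≈ w
  ≈⁺ all p with p ∈ˡ? P
  ... | yes p∈P = All.lookup all p∈P
  ... | no  p∉P = v~w p p∉P

-- Exhaustive search, branching on the value of each variable of `P`. `Q` has to be decided only at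
-- the candidates, which is what makes the search usable for `⟦ π ⟧ v`, decidable only between
-- agreeing valuations.
∃-Agree? : ∀ P v {Q : Pred (Valuation n) 0ℓ} →
           (∀ {w w′} → w ≈ w′ → Q w → Q w′) →
           (∀ w → Agree P v w → Dec (Q w)) →
           Dec (∃ λ w → Agree P v w × Q w)
∃-Agree? []      v Q-resp Q? = map′
  (λ qv → v , (λ _ _ → refl) , qv)
  (λ (w , v~w , qw) → Q-resp (λ p → sym (v~w p (λ ()))) qw)
  (Q? v (λ _ _ → refl))
∃-Agree? (p ∷ P) v {Q} Q-resp Q? = map′
  (λ { (inj₁ found) → widen true found ; (inj₂ found) → widen false found })
  (λ (w , v~w , qw) → narrow w v~w qw (w p) refl)
  (branch? true ⊎-dec branch? false)
  where
  Branch : Bool → Set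
  Branch b = ∃ λ w → Agree P (update p b v) w × Q w

  extend : ∀ b {w} → Agree P (update p b v) w → Agree (p ∷ P) v w
  extend b v~w = Agree-trans (Agree-update (here refl)) (Agree-∷ v~w)

  branch? : ∀ b → Dec (Branch b)
  branch? b = ∃-Agree? P (update p b v) Q-resp (λ w → Q? w ∘ extend b)

  widen : ∀ b → Branch b → ∃ λ w → Agree (p ∷ P) v w × Q w
  widen b (w , v~w , qw) = w , extend b v~w , qw

  agrees : ∀ {b w} → w p ≡ b → Agree (p ∷ P) v w → Agree P (update p b v) w
  agrees {b} {w} wp≡b v~w q q∉P with p ≟ q
  ... | yes refl = sym wp≡b
  ... | no  p≢q  = v~w q (λ { (here q≡p) → p≢q (sym q≡p) ; (there q∈P) → q∉P q∈P })

  narrow : ∀ w → Agree (p ∷ P) v w → Q w → ∀ b → w p ≡ b → Branch true ⊎ Branch false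
  narrow w v~w qw true  wp≡b = inj₁ (w , agrees wp≡b v~w , qw)
  narrow w v~w qw false wp≡b = inj₂ (w , agrees wp≡b v~w , qw)

assign? : ∀ b (p : Prp n) P v w → Agree P v w → Dec (⟦ assign b p ⟧ v w)
assign? b p P v w v~w = map′ (from (⟦assign⟧ b p v w)) (to (⟦assign⟧ b p v w))
  (≈-dec (p ∷ P) w (update p b v)
    (Agree-trans (Agree-∷ (Agree-sym v~w)) (Agree-update (here refl))))

infix 2 _⊨?_

mutual
  -- A box is refuted by a successor falsifying `φ`, and every successor agrees with `v` off
  -- `vars π`; so finitely many candidates decide it.
  _⊨?_ : (v : Valuation n) (φ : Formula n) → Dec (v ⊨ φ)
  v ⊨? var p     = Bool.T? (v p)
  v ⊨? ∼ φ       = ¬? (v ⊨? φ)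
  v ⊨? φ ∧ ψ     = (v ⊨? φ) ×-dec (v ⊨? ψ)
  v ⊨? [ π ] φ   = map′ ⊨⁺ ⊨⁻ (¬? (∃-Agree? (vars π) v Counter-resp Counter?))
    where
    Counter : Pred (Valuation _) 0ℓ
    Counter w = ⟦ π ⟧ v w × ¬ (w ⊨ φ)

    Counter-resp : ∀ {w w′} → w ≈ w′ → Counter w → Counter w′
    Counter-resp w≈w′ = Product.map (⟦⟧-resp-≈ π ≈-refl w≈w′) (⊨-resp-≈ (∼ φ) w≈w′)

    Counter? : ∀ w → Agree (vars π) v w → Dec (Counter w)
    Counter? w v~w = ⟦ π ⟧? (vars π) v w v~w ×-dec ¬? (w ⊨? φ)

    ⊨⁺ : ¬ (∃ λ w → Agree (vars π) v w × Counter w) → v ⊨ [ π ] φ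
    ⊨⁺ none w vπw = decidable-stable (w ⊨? φ) (λ w⊭φ → none (w , ⟦⟧⇒Agree π vπw , vπw , w⊭φ))

    ⊨⁻ : v ⊨ [ π ] φ → ¬ (∃ λ w → Agree (vars π) v w × Counter w)
    ⊨⁻ v⊨ (w , _ , vπw , w⊭φ) = w⊭φ (v⊨ w vπw)

  ⟦_⟧? : ∀ (π : Program n) P v w → Agree P v w → Dec (⟦ π ⟧ v w)
  ⟦ + p ⟧? P v w v~w = assign? true p P v w v~w
  ⟦ - p ⟧? P v w v~w = assign? false p P v w v~w
  ⟦ test φ ⟧? P v w v~w = map′ ≈⇒≐ ≐⇒≈ (≈-dec P w v (Agree-sym v~w)) ×-dec (v ⊨? φ)
  ⟦ π ⨾ ρ ⟧? P v w v~w = map′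
    (λ (u , _ , vπu , uρw) → u , vπu , uρw)
    (λ (u , vπu , uρw) → u , ⟦⟧⇒Agree π vπu , vπu , uρw)
    (∃-Agree? (vars π) v Middle-resp Middle?)
    where
    Middle : Pred (Valuation _) 0ℓ
    Middle u = ⟦ π ⟧ v u × ⟦ ρ ⟧ u w

    Middle-resp : ∀ {u u′} → u ≈ u′ → Middle u → Middle u′
    Middle-resp u≈u′ = Product.map (⟦⟧-resp-≈ π ≈-refl u≈u′) (⟦⟧-resp-≈ ρ u≈u′ ≈-refl)

    Middle? : ∀ u → Agree (vars π) v u → Dec (Middle u)
    -- The list of allowed differences grows: the midpoint differs from `v` within `vars π` and `v`
    -- from `w` within `P`, so the midpoint and `w` differ within `vars π ++ P`.
    Middle? u v~u = ⟦ π ⟧? (vars π) v u v~u ×-dec ⟦ ρ ⟧? (vars π ++ P) u w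
      (Agree-trans (Agree-++ˡ (Agree-sym v~u)) (Agree-++ʳ {Q = vars π} v~w))
  ⟦ π ⋓ ρ ⟧? P v w v~w = ⟦ π ⟧? P v w v~w ⊎-dec ⟦ ρ ⟧? P v w v~w
  ⟦ π ⁻¹ ⟧? P v w v~w = ⟦ π ⟧? P w v (Agree-sym v~w)

⊨-⟨⟩ : ∀ (π : Program n) φ v → (v ⊨ ⟨ π ⟩ φ) ⇔ ∃ λ w → ⟦ π ⟧ v w × (w ⊨ φ)
⊨-⟨⟩ {n} π φ v = mk⇔ witness (λ (w , vπw , w⊨φ) none → none w vπw w⊨φ)
  where
  Witness : Pred (Valuation n) 0ℓ
  Witness w = ⟦ π ⟧ v w × (w ⊨ φ)

  Witness-resp : ∀ {w w′} → w ≈ w′ → Witness w → Witness w′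
  Witness-resp w≈w′ = Product.map (⟦⟧-resp-≈ π ≈-refl w≈w′) (⊨-resp-≈ φ w≈w′)

  Witness? : ∀ w → Agree (vars π) v w → Dec (Witness w)
  Witness? w v~w = ⟦ π ⟧? (vars π) v w v~w ×-dec (w ⊨? φ)

  witness : v ⊨ ⟨ π ⟩ φ → ∃ Witness
  witness v⊨ with ∃-Agree? (vars π) v Witness-resp Witness?
  ... | yes (w , _ , h) = w , h
  ... | no none = contradiction
    (λ w vπw w⊨φ → none (w , ⟦⟧⇒Agree π vπw , vπw , w⊨φ)) v⊨

-- Semantics of the basic programs

⊨-⊤ : (v : Valuation n) → v ⊨ ⊤
⊨-⊤ v (t , ¬t) = ¬t t

⟦skip⟧⁺ : w ≈ v → ⟦ skip ⟧ v w
⟦skip⟧⁺ {v = v} w≈v = ≈⇒≐ w≈v , ⊨-⊤ v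

-- An invariant rule for runs. `J` is what every step guarantees between its ends and accumulates by
-- transitivity; `K i` is what step `i` establishes and the later steps, all within `J`, cannot
-- destroy.
sequence-sound :
  (π : I → Program n) {J : Rel (Valuation n) 0ℓ} {K : I → Pred (Valuation n) 0ℓ} →
  (∀ {v w} → v ≈ w → J v w) → Transitive J → (∀ {i v w} → K i v → J v w → K i w) →
  ∀ L → (∀ {i v w} → i ∈ˡ L → ⟦ π i ⟧ v w → J v w × K i w) →
  ⟦ sequence (map π L) ⟧ v w → J v w × (∀ {i} → i ∈ˡ L → K i w)
sequence-sound π J-refl J-trans K-resp [] step (w≐v , _) = J-refl (≈-sym (≐⇒≈ w≐v)) , λ ()
sequence-sound π {J} {K} J-refl J-trans K-resp (i ∷ L) step (u , vu , uw)
  with step (here refl) vu | sequence-sound π {J} {K} J-refl J-trans K-resp L (step ∘ there) uw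
... | Jvu , Kiu | Juw , Kw =
  J-trans Jvu Juw , λ { (here refl) → K-resp Kiu Juw ; (there i∈L) → Kw i∈L }

-- A run reaches w when each step can move one variable to its value in w
-- from any valuation between v and w, and every variable on which v and w
-- differ is moved by some step.
sequence-complete :
  (π : I → Program n) (target : I → Prp n) (v w : Valuation n) (L : List I) →
  (∀ {i} → i ∈ˡ L → ∀ u → (∀ p → u p ≡ v p ⊎ u p ≡ w p) →
    ⟦ π i ⟧ u (update (target i) (w (target i)) u)) →
  (∀ p → v p ≡ w p ⊎ ∃ λ i → i ∈ˡ L × p ≡ target i) →
  ⟦ sequence (map π L) ⟧ v w
sequence-complete {n = n} π target v w L step cover =
  go L step v (λ p → inj₁ refl) cover
  where
  Between : Pred (Valuation n) 0ℓ
  Between u = ∀ p → u p ≡ v p ⊎ u p ≡ w p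

  go : ∀ L →
       (∀ {i} → i ∈ˡ L → ∀ u → Between u → ⟦ π i ⟧ u (update (target i) (w (target i)) u)) →
       ∀ u → Between u → (∀ p → u p ≡ w p ⊎ ∃ λ i → i ∈ˡ L × p ≡ target i) →
       ⟦ sequence (map π L) ⟧ u w
  go [] step u btw cover = ⟦skip⟧⁺ w≈u
    where
    w≈u : w ≈ u
    w≈u p with cover p
    ... | inj₁ up≡wp = sym up≡wp
  go (i ∷ L) step u btw cover =
    u′ , step (here refl) u btw , go L (step ∘ there) u′ btw′ cover′
    where
    u′ : Valuation n
    u′ = update (target i) (w (target i)) u

    btw′ : Between u′
    btw′ p with target i ≟ p
    ... | yes refl = inj₂ refl
    ... | no  _    = btw p

    cover′ : ∀ p → u′ p ≡ w p ⊎ ∃ λ i → i ∈ˡ L × p ≡ target i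
    cover′ p with target i ≟ p
    ... | yes refl = inj₁ refl
    ... | no  t≢p with cover p
    ...   | inj₁ up≡wp                   = inj₁ up≡wp
    ...   | inj₂ (_ , here refl , p≡t)   = contradiction (sym p≡t) t≢p
    ...   | inj₂ (j , there j∈L , p≡t)   = inj₂ (j , j∈L , p≡t)

assign-update : ∀ b (p : Prp n) {c} u → c ≡ b → ⟦ assign b p ⟧ u (update p c u)
assign-update b p u refl = from (⟦assign⟧ b p u _) ≈-refl

update-self : ∀ (p : Prp n) {b} u → u p ≡ b → update p b u ≈ u
update-self p u up≡b = ≈-sym (update-unique p up≡b (λ _ _ → refl))

⟦vary⟧ : ⟦ vary P ⟧ v w ⇔ Agree P v w
⟦vary⟧ {n} {P} {v} {w} = mk⇔ sound complete
  where
  step : Prp n → Program n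
  step p = + p ⋓ - p

  step-sound : ∀ {p v w} → p ∈ˡ P → ⟦ step p ⟧ v w → Agree P v w × Unit
  step-sound {p} p∈P (inj₁ vw) = Agree-trans (Agree-update p∈P)
    (λ q _ → sym (to (⟦assign⟧ true p _ _) vw q)) , tt
  step-sound {p} p∈P (inj₂ vw) = Agree-trans (Agree-update p∈P)
    (λ q _ → sym (to (⟦assign⟧ false p _ _) vw q)) , tt

  sound : ⟦ vary P ⟧ v w → Agree P v w
  sound vw = proj₁ (sequence-sound step {Agree P} {λ _ _ → Unit}
    (λ v≈w p _ → v≈w p) Agree-trans (λ _ _ → tt) P step-sound vw)

  step-complete : ∀ p b u → ⟦ step p ⟧ u (update p b u)
  step-complete p true  u = inj₁ (assign-update true p u refl)
  step-complete p false u = inj₂ (assign-update false p u refl)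

  cover : Agree P v w → ∀ p → v p ≡ w p ⊎ ∃ λ i → i ∈ˡ P × p ≡ i
  cover v~w p with p ∈ˡ? P
  ... | yes p∈P = inj₂ (p , p∈P , refl)
  ... | no  p∉P = inj₁ (v~w p p∉P)

  complete : Agree P v w → ⟦ vary P ⟧ v w
  complete v~w = sequence-complete step id v w P
    (λ {p} _ u _ → step-complete p (w p) u) (cover v~w)

Assigns : Bool → Pred (Prp n) 0ℓ → Rel (Valuation n) 0ℓ
Assigns b S v w = ∀ p → v p ≡ w p ⊎ (S p × w p ≡ b)

Assigns-trans : ∀ {b} {S : Pred (Prp n) 0ℓ} → Transitive (Assigns b S)
Assigns-trans {i = u} {v} {w} uv vw p with vw p
... | inj₂ sets = inj₂ sets
... | inj₁ vp≡wp with uv p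
...   | inj₁ up≡vp       = inj₁ (trans up≡vp vp≡wp)
...   | inj₂ (Sp , vp≡b) = inj₂ (Sp , trans (sym vp≡wp) vp≡b)

Assigns-preserves : ∀ {b} {S : Pred (Prp n) 0ℓ} → Assigns b S v w → ∀ p → v p ≡ b → w p ≡ b
Assigns-preserves vw p vp≡b with vw p
... | inj₁ vp≡wp      = trans (sym vp≡wp) vp≡b
... | inj₂ (_ , wp≡b) = wp≡b

assign-Assigns : ∀ {b} {S : Pred (Prp n) 0ℓ} {p} → S p → ⟦ assign b p ⟧ v w → Assigns b S v w
assign-Assigns {v = v} {w} {b} {p = p} Sp vw q with p ≟ q | to (⟦assign⟧ b p v w) vw q
... | yes refl | wq≡ = inj₂ (Sp , wq≡)
... | no  _    | wq≡ = inj₁ (sym wq≡)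

someStep : Bool → Prp n → Program n
someStep b p = assign b p ⋓ skip

⟦mkSome⟧ : ∀ b → ⟦ sequence (map (someStep b) P) ⟧ v w ⇔ Assigns b (_∈ˡ P) v w
⟦mkSome⟧ {n} {P} {v} {w} b = mk⇔ sound complete
  where
  step-sound : ∀ {p v w} → p ∈ˡ P → ⟦ someStep b p ⟧ v w → Assigns b (_∈ˡ P) v w × Unit
  step-sound p∈P (inj₁ vw)        = assign-Assigns p∈P vw , tt
  step-sound p∈P (inj₂ (w≐v , _)) = (λ q → inj₁ (sym (≐⇒≈ w≐v q))) , tt

  sound : ⟦ sequence (map (someStep b) P) ⟧ v w → Assigns b (_∈ˡ P) v w
  sound vw = proj₁ (sequence-sound (someStep b) {Assigns b (_∈ˡ P)} {λ _ _ → Unit}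
    (λ v≈w p → inj₁ (v≈w p)) Assigns-trans (λ _ _ → tt) P step-sound vw)

  module _ (v⇝w : Assigns b (_∈ˡ P) v w) where
    step-complete : ∀ p u → u p ≡ v p ⊎ u p ≡ w p → ⟦ someStep b p ⟧ u (update p (w p) u)
    step-complete p u (inj₂ up≡wp) = inj₂ (⟦skip⟧⁺ (update-self p u up≡wp))
    step-complete p u (inj₁ up≡vp) with v⇝w p
    ... | inj₁ vp≡wp      = inj₂ (⟦skip⟧⁺ (update-self p u (trans up≡vp vp≡wp)))
    ... | inj₂ (_ , wp≡b) = inj₁ (assign-update b p u wp≡b)

    complete : ⟦ sequence (map (someStep b) P) ⟧ v w
    complete = sequence-complete (someStep b) id v w P
      (λ {p} _ u btw → step-complete p u (btw p))
      (λ p → Sum.map₂ (λ (p∈P , _) → p , p∈P , refl) (v⇝w p))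

-- The membership certifies that the union is non-empty: the empty union is `skip`, which has runs
-- although no member does.
⟦union⟧⁻ : ∀ {πs : List (Program n)} {ρ} → ρ ∈ˡ πs → ⟦ union πs ⟧ v w → Any (λ π → ⟦ π ⟧ v w) πs
⟦union⟧⁻ {πs = π ∷ []}     _ vw        = here vw
⟦union⟧⁻ {πs = π ∷ ρ ∷ πs} _ (inj₁ vw) = here vw
⟦union⟧⁻ {πs = π ∷ ρ ∷ πs} _ (inj₂ vw) = there (⟦union⟧⁻ (here refl) vw)

⟦union⟧⁺ : ∀ {πs : List (Program n)} → Any (λ π → ⟦ π ⟧ v w) πs → ⟦ union πs ⟧ v w
⟦union⟧⁺ {πs = π ∷ []}     (here vw) = vw
⟦union⟧⁺ {πs = π ∷ ρ ∷ πs} (here vw) = inj₁ vw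
⟦union⟧⁺ {πs = π ∷ ρ ∷ πs} (there a) = inj₂ (⟦union⟧⁺ a)

oneStep : Bool → Prp n → Program n
oneStep b p = test (literal (Bool.not b) p) ⨾ assign b p

⟦oneStep⟧ : ∀ b (p : Prp n) → ⟦ oneStep b p ⟧ v w ⇔ (v p ≡ Bool.not b × w ≈ update p b v)
⟦oneStep⟧ {v = v} {w} b p = mk⇔
  (λ (u , (u≐v , v⊨) , uw) → to (⊨-literal (Bool.not b) p v) v⊨ ,
    ≈-trans (to (⟦assign⟧ b p u w) uw) (update-cong p b (≐⇒≈ u≐v)))
  (λ (vp , w≈) → v , (≈⇒≐ ≈-refl , from (⊨-literal (Bool.not b) p v) vp) ,
    from (⟦assign⟧ b p v w) w≈)

⟦mkOne⟧ : ∀ b → p ∈ˡ P → ⟦ union (map (oneStep b) P) ⟧ v w ⇔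
          (∃ λ q → q ∈ˡ P × v q ≡ Bool.not b × w ≈ update q b v)
⟦mkOne⟧ {n} {p} {P} {v} {w} b p∈P = mk⇔ sound complete
  where
  sound : ⟦ union (map (oneStep b) P) ⟧ v w → ∃ λ q → q ∈ˡ P × v q ≡ Bool.not b × w ≈ update q b v
  sound vw with find (map⁻ (⟦union⟧⁻ (∈-map⁺ (oneStep b) p∈P) vw))
  ... | q , q∈P , step = q , q∈P , to (⟦oneStep⟧ b q) step

  complete : (∃ λ q → q ∈ˡ P × v q ≡ Bool.not b × w ≈ update q b v) →
             ⟦ union (map (oneStep b) P) ⟧ v w
  complete (q , q∈P , h) = ⟦union⟧⁺ (lose (∈-map⁺ (oneStep b) q∈P) (from (⟦oneStep⟧ b q) h))

Strictly : Bool → List (Prp n) → Rel (Valuation n) 0ℓ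
Strictly b P v w = Assigns b (_∈ˡ P) v w × ∃ λ p → p ∈ˡ P × v p ≡ Bool.not b × w p ≡ b

-- The first program forces one genuine change, the second allows any further changes in the same
-- direction.
⟦strictly⟧ : ∀ b → p ∈ˡ P →
  ⟦ union (map (oneStep b) P) ⨾ sequence (map (someStep b) P) ⟧ v w ⇔ Strictly b P v w
⟦strictly⟧ {n} {p} {P} {v} {w} b p∈P = mk⇔ sound complete
  where
  sound : ⟦ union (map (oneStep b) P) ⨾ sequence (map (someStep b) P) ⟧ v w → Strictly b P v w
  sound (u , vu , uw) with to (⟦mkOne⟧ b p∈P) vu | to (⟦mkSome⟧ b) uw
  ... | q , q∈P , vq , u≈ | u⇝w = Assigns-trans v⇝u u⇝w , q , q∈P , vq ,
      Assigns-preserves u⇝w q (trans (u≈ q) (update-≡ q b v))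
    where
    v⇝u : Assigns b (_∈ˡ P) v u
    v⇝u = assign-Assigns q∈P (from (⟦assign⟧ b q v u) u≈)

  complete : Strictly b P v w → ⟦ union (map (oneStep b) P) ⨾ sequence (map (someStep b) P) ⟧ v w
  -- The variable witnessing strictness is flipped first; at every other variable the midpoint still
  -- equals `v`.
  complete (v⇝w , q , q∈P , vq , wq) = update q b v ,
    from (⟦mkOne⟧ b p∈P) (q , q∈P , vq , ≈-refl) , from (⟦mkSome⟧ b) rest
    where
    rest : Assigns b (_∈ˡ P) (update q b v) w
    rest s with q ≟ s
    ... | yes refl = inj₁ (sym wq)
    ... | no  _    = v⇝w s

copied : Valuation n → Valuation n
copied v (aw x)    = v (aw x)
copied v (inn x)   = v (inn x)
copied v (inn′ x)  = v (inn x)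
copied v (r x y)   = v (r x y)
copied v (other k) = v (other k)

copied-update : ∀ (x : Fin n) b v → copied (update (inn′ x) b v) ≈ copied v
copied-update x b v (aw y)    = update-≢ b v λ ()
copied-update x b v (inn y)   = update-≢ b v λ ()
copied-update x b v (inn′ y)  = update-≢ b v λ ()
copied-update x b v (r y z)   = update-≢ b v λ ()
copied-update x b v (other k) = update-≢ b v λ ()

copied-cong : v ≈ w → copied v ≈ copied w
copied-cong v≈w (aw x)    = v≈w (aw x)
copied-cong v≈w (inn x)   = v≈w (inn x)
copied-cong v≈w (inn′ x)  = v≈w (inn x)
copied-cong v≈w (r x y)   = v≈w (r x y)
copied-cong v≈w (other k) = v≈w (other k)

≈copied : (∀ x → v (inn′ x) ≡ v (inn x)) → v ≈ copied v
≈copied h (aw x)    = refl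
≈copied h (inn x)   = refl
≈copied h (inn′ x)  = h x
≈copied h (r x y)   = refl
≈copied h (other k) = refl

⟦copyIN⟧ : ⟦ copyIN ⟧ v w ⇔ w ≈ copied v
⟦copyIN⟧ {n} {v} {w} = mk⇔
  (sound ∘ subst (λ πs → ⟦ sequence πs ⟧ v w) (sym (map-tabulate id step)))
  (subst (λ πs → ⟦ sequence πs ⟧ v w) (map-tabulate id step) ∘ complete)
  where
  step : Fin n → Program n
  step x = (test (var (inn x)) ⨾ + inn′ x) ⋓ (test (∼ var (inn x)) ⨾ - inn′ x)

  ⟦step⟧⁻ : ∀ {x v w} → ⟦ step x ⟧ v w → w ≈ update (inn′ x) (v (inn x)) v
  ⟦step⟧⁻ {x} {v} {w} (inj₁ (u , (u≐v , t) , uw)) =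
    subst (λ b → w ≈ update (inn′ x) b v) (sym (to (⊨-literal true (inn x) v) t))
      (≈-trans (to (⟦assign⟧ true _ u w) uw) (update-cong _ true (≐⇒≈ u≐v)))
  ⟦step⟧⁻ {x} {v} {w} (inj₂ (u , (u≐v , f) , uw)) =
    subst (λ b → w ≈ update (inn′ x) b v) (sym (to (⊨-literal false (inn x) v) f))
      (≈-trans (to (⟦assign⟧ false _ u w) uw) (update-cong _ false (≐⇒≈ u≐v)))

  ⟦step⟧⁺ : ∀ x u b → u (inn x) ≡ b → ⟦ step x ⟧ u (update (inn′ x) b u)
  ⟦step⟧⁺ x u true  eq = inj₁ (u , (≈⇒≐ ≈-refl , from (⊨-literal true (inn x) u) eq) ,
    assign-update true _ u refl)
  ⟦step⟧⁺ x u false eq = inj₂ (u , (≈⇒≐ ≈-refl , from (⊨-literal false (inn x) u) eq) ,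
    assign-update false _ u refl)

  -- Because `copied` overwrites all primed variables, the first half says that nothing else has
  -- changed. The second half keeps `K` stable: a primed variable is either left alone or set to its
  -- correct value.
  J : Rel (Valuation n) 0ℓ
  J v w = copied v ≈ copied w × ∀ x → w (inn′ x) ≡ v (inn′ x) ⊎ w (inn′ x) ≡ w (inn x)

  K : Fin n → Pred (Valuation n) 0ℓ
  K x v = v (inn′ x) ≡ v (inn x)

  J-trans : Transitive J
  J-trans {u} {v} {w} (u≈v , uv) (v≈w , vw) = ≈-trans u≈v v≈w , λ x → helper x (vw x) (uv x)
    where
    helper : ∀ x → w (inn′ x) ≡ v (inn′ x) ⊎ w (inn′ x) ≡ w (inn x) →
      v (inn′ x) ≡ u (inn′ x) ⊎ v (inn′ x) ≡ v (inn x) →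
      w (inn′ x) ≡ u (inn′ x) ⊎ w (inn′ x) ≡ w (inn x)
    helper x (inj₂ e) _        = inj₂ e
    helper x (inj₁ e) (inj₁ f) = inj₁ (trans e f)
    helper x (inj₁ e) (inj₂ f) = inj₂ (trans e (trans f (v≈w (inn x))))

  K-resp : ∀ {x v w} → K x v → J v w → K x w
  K-resp {x} Kv (v≈w , vw) with vw x
  ... | inj₁ e = trans e (trans Kv (v≈w (inn x)))
  ... | inj₂ e = e

  step-sound : ∀ {x v w} → x ∈ˡ allFin n → ⟦ step x ⟧ v w → J v w × K x w
  step-sound {x} {v} {w} _ vw = (≈-sym w≈v , moved) , Kx
    where
    w≈ : w ≈ update (inn′ x) (v (inn x)) v
    w≈ = ⟦step⟧⁻ vw

    w≈v : copied w ≈ copied v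
    w≈v = ≈-trans (copied-cong w≈) (copied-update x _ v)

    Kx : K x w
    Kx = trans (w≈ (inn′ x)) (trans (update-≡ (inn′ x) _ v) (sym (w≈v (inn x))))

    moved : ∀ y → w (inn′ y) ≡ v (inn′ y) ⊎ w (inn′ y) ≡ w (inn y)
    moved y with inn′ x ≟ inn′ y | w≈ (inn′ y)
    ... | yes refl | _  = inj₂ Kx
    ... | no  _    | eq = inj₁ eq

  sound : ⟦ sequence (map step (allFin n)) ⟧ v w → w ≈ copied v
  sound vw with sequence-sound step {J} {K}
    (λ v≈w → copied-cong v≈w , λ x → inj₁ (sym (v≈w (inn′ x))))
    J-trans K-resp (allFin n) step-sound vw
  ... | (v≈w , _) , Kw = ≈-trans (≈copied (λ x → Kw (∈-allFin x))) (≈-sym v≈w)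

  complete : w ≈ copied v → ⟦ sequence (map step (allFin n)) ⟧ v w
  complete w≈ = sequence-complete step inn′ v w (allFin n)
    -- At `inn x` the valuations `v` and `w` coincide, so any valuation between them copies the
    -- value required by `w`.
    (λ {x} _ u btw → ⟦step⟧⁺ x u (w (inn′ x)) (trans
      (Sum.[ id , (λ e → trans e (w≈ (inn x))) ] (btw (inn x))) (sym (w≈ (inn′ x)))))
    cover
    where
    cover : ∀ p → v p ≡ w p ⊎ ∃ λ x → x ∈ˡ allFin n × p ≡ inn′ x
    cover (aw x)    = inj₁ (sym (w≈ (aw x)))
    cover (inn x)   = inj₁ (sym (w≈ (inn x)))
    cover (inn′ x)  = inj₂ (x , ∈-allFin x , refl)
    cover (r x y)   = inj₁ (sym (w≈ (r x y)))
    cover (other k) = inj₁ (sym (w≈ (other k)))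

∈-pairs : ∀ (R : Attacks n) {x y} → (x , y) ∈ˡ pairs R ⇔ (x , y) ∈ʳ R
∈-pairs R {x} {y} = mk⇔
  (proj₂ ∘ ∈-filter⁻ (λ (x , y) → Bool.T? (R x y))
    {xs = List.cartesianProduct (allFin _) (allFin _)})
  (∈-filter⁺ (λ (x , y) → Bool.T? (R x y)) (∈-cartesianProduct⁺ (∈-allFin x) (∈-allFin y)))

∈-ATT⁻ : ∀ (R : Attacks n) → p ∈ˡ ATT R → ∃₂ λ x y → (x , y) ∈ʳ R × p ≡ r x y
∈-ATT⁻ R p∈ with ∈-map⁻ _ p∈
... | (x , y) , xy∈ , p≡ = x , y , to (∈-pairs R) xy∈ , p≡

∈-ATT⁺ : ∀ (R : Attacks n) {x y} → (x , y) ∈ʳ R → r x y ∈ˡ ATT R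
∈-ATT⁺ R xy∈R = ∈-map⁺ (λ (x , y) → r x y) (from (∈-pairs R) xy∈R)

∈-AW⁻ : ∀ (A : Subset n) → p ∈ˡ AW A → ∃ λ x → x Subset.∈ A × p ≡ aw x
∈-AW⁻ A p∈ with ∈-map⁻ aw p∈
... | x , x∈ , p≡ = x , proj₂ (∈-filter⁻ (_∈? A) {xs = allFin _} x∈) , p≡

∈-AW⁺ : ∀ (A : Subset n) {x} → x Subset.∈ A → aw x ∈ˡ AW A
∈-AW⁺ A x∈A = ∈-map⁺ aw (∈-filter⁺ (_∈? A) (∈-allFin _) x∈A)

module _ (R : Attacks n) (R-sym : Symmetric (λ x y → (x , y) ∈ʳ R)) where
  private
    step : Fin n × Fin n → Program n
    step (x , y) = + r x y ⋓ + r y x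

    Some : Fin n × Fin n → Pred (Valuation n) 0ℓ
    Some (x , y) w = w (r x y) ≡ true ⊎ w (r y x) ≡ true

  -- Symmetry keeps both variables of a step inside `ATT R`. Since both orientations of each pair
  -- occur in the list, a run may also end with both attacks on.
  ⟦dis⟧ : ⟦ dis R ⟧ v w ⇔
    (Assigns true (_∈ˡ ATT R) v w × ∀ x y → (x , y) ∈ʳ R → w (r x y) ≡ true ⊎ w (r y x) ≡ true)
  ⟦dis⟧ {v} {w} = mk⇔ sound (λ (v⇝w , some) → complete v⇝w some)
    where
    step-sound : ∀ {i v w} → i ∈ˡ pairs R → ⟦ step i ⟧ v w → Assigns true (_∈ˡ ATT R) v w × Some i w
    step-sound {x , y} {v} {w} xy∈ (inj₁ vw) =
      assign-Assigns (∈-ATT⁺ R (to (∈-pairs R) xy∈)) vw ,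
      inj₁ (trans (to (⟦assign⟧ true (r x y) v w) vw _) (update-≡ (r x y) true v))
    step-sound {x , y} {v} {w} xy∈ (inj₂ vw) =
      assign-Assigns (∈-ATT⁺ R (R-sym (to (∈-pairs R) xy∈))) vw ,
      inj₂ (trans (to (⟦assign⟧ true (r y x) v w) vw _) (update-≡ (r y x) true v))

    sound : ⟦ dis R ⟧ v w → Assigns true (_∈ˡ ATT R) v w ×
      ∀ x y → (x , y) ∈ʳ R → w (r x y) ≡ true ⊎ w (r y x) ≡ true
    sound vw with sequence-sound step {Assigns true (_∈ˡ ATT R)} {Some}
      (λ v≈w p → inj₁ (v≈w p)) Assigns-trans
      (λ some v⇝w → Sum.map (Assigns-preserves v⇝w _) (Assigns-preserves v⇝w _) some)
      (pairs R) step-sound vw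
    ... | v⇝w , some = v⇝w , λ x y xy∈R → some (from (∈-pairs R) xy∈R)

    target : Fin n × Fin n → Prp n
    target (x , y) = if w (r x y) then r x y else r y x

    module _ (v⇝w : Assigns true (_∈ˡ ATT R) v w)
             (some : ∀ x y → (x , y) ∈ʳ R → w (r x y) ≡ true ⊎ w (r y x) ≡ true) where
      step-complete : ∀ x y u → Some (x , y) w →
        ⟦ step (x , y) ⟧ u (update (target (x , y)) (w (target (x , y))) u)
      step-complete x y u s with w (r x y) in eq
      ... | true  = inj₁ (assign-update true (r x y) u eq)
      step-complete x y u (inj₂ e) | false = inj₂ (assign-update true (r y x) u e)

      cover : ∀ p → v p ≡ w p ⊎ ∃ λ i → i ∈ˡ pairs R × p ≡ target i
      cover p with v⇝w p
      ... | inj₁ e = inj₁ e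
      ... | inj₂ (p∈ , wp) with ∈-ATT⁻ R p∈
      ...   | x , y , xy∈R , refl = inj₂ ((x , y) , from (∈-pairs R) xy∈R ,
              cong (if_then r x y else r y x) (sym wp))

      complete : ⟦ dis R ⟧ v w
      complete = sequence-complete step target v w (pairs R)
        (λ {(x , y)} xy∈ u _ → step-complete x y u (some x y (to (∈-pairs R) xy∈))) cover

-- Argumentation semantics

⊨-⇒ : ∀ φ ψ (v : Valuation n) → (v ⊨ φ ⇒ ψ) ⇔ (v ⊨ φ → v ⊨ ψ)
⊨-⇒ φ ψ v = mk⇔
  (λ h v⊨φ → decidable-stable (v ⊨? ψ) (λ v⊭ψ → h (v⊨φ , v⊭ψ)))
  (λ h (v⊨φ , v⊭ψ) → v⊭ψ (h v⊨φ))

⊨-∨ : ∀ φ ψ (v : Valuation n) → (v ⊨ φ ∨ ψ) ⇔ ((v ⊨ φ) ⊎ (v ⊨ ψ))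
⊨-∨ φ ψ v = mk⇔
  (λ h → decidable-stable ((v ⊨? φ) ⊎-dec (v ⊨? ψ)) (λ ¬s → h (¬s ∘ inj₁ , ¬s ∘ inj₂)))
  (λ s (v⊭φ , v⊭ψ) → Sum.[ v⊭φ , v⊭ψ ] s)

⊨-↔ : ∀ φ ψ (v : Valuation n) → (v ⊨ φ ↔ ψ) ⇔ ((v ⊨ φ) ⇔ (v ⊨ ψ))
⊨-↔ φ ψ v = mk⇔
  (λ (f , g) → mk⇔ (to (⊨-⇒ φ ψ v) f) (to (⊨-⇒ ψ φ v) g))
  (λ e → from (⊨-⇒ φ ψ v) (to e) , from (⊨-⇒ ψ φ v) (from e))

-- The index bound `m` is separated from the number `n` of arguments so that induction on it leaves
-- the formulas alone.
⊨-foldr-∧ : ∀ {m} (φ : Fin m → Formula n) v →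
            (v ⊨ foldr _∧_ ⊤ (tabulate φ)) ⇔ (∀ x → v ⊨ φ x)
⊨-foldr-∧ {m = ℕ.zero}  φ v = mk⇔ (λ _ ()) (λ _ → ⊨-⊤ v)
⊨-foldr-∧ {m = ℕ.suc m} φ v = mk⇔
  (λ { (h , _) zero → h ; (_ , hs) (suc x) → to (⊨-foldr-∧ (φ ∘ suc) v) hs x })
  (λ h → h zero , from (⊨-foldr-∧ (φ ∘ suc) v) (h ∘ suc))

⊨-foldr-∨ : ∀ {m} (φ : Fin m → Formula n) v →
            (v ⊨ foldr _∨_ ⊥ (tabulate φ)) ⇔ (∃ λ x → v ⊨ φ x)
⊨-foldr-∨ {m = ℕ.zero}  φ v = mk⇔ (λ h → contradiction (⊨-⊤ v) h) (λ ())
⊨-foldr-∨ {m = ℕ.suc m} φ v = mk⇔ split join ⇔-∘ ⊨-∨ (φ zero) (foldr _∨_ ⊥ (tabulate (φ ∘ suc))) v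
  where
  split : (v ⊨ φ zero) ⊎ (v ⊨ foldr _∨_ ⊥ (tabulate (φ ∘ suc))) → ∃ λ x → v ⊨ φ x
  split (inj₁ h) = zero , h
  split (inj₂ h) = Product.map suc id (to (⊨-foldr-∨ (φ ∘ suc) v) h)

  join : (∃ λ x → v ⊨ φ x) → (v ⊨ φ zero) ⊎ (v ⊨ foldr _∨_ ⊥ (tabulate (φ ∘ suc)))
  join (zero  , h) = inj₁ h
  join (suc x , h) = inj₂ (from (⊨-foldr-∨ (φ ∘ suc) v) (x , h))

⊨-⋀ : ∀ φ (v : Valuation n) → (v ⊨ ⋀ φ) ⇔ (∀ x → v ⊨ φ x)
⊨-⋀ = ⊨-foldr-∧

⊨-⋁ : ∀ φ (v : Valuation n) → (v ⊨ ⋁ φ) ⇔ (∃ λ x → v ⊨ φ x)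
⊨-⋁ = ⊨-foldr-∨

∀-cong-⇔ : ∀ {A : Set} {B C : Pred A 0ℓ} → (∀ x → B x ⇔ C x) → (∀ x → B x) ⇔ (∀ x → C x)
∀-cong-⇔ B⇔C = mk⇔ (λ b x → to (B⇔C x) (b x)) (λ c x → from (B⇔C x) (c x))

-- The second equivalence may assume the first conjunct. This is how `Well` or `ConFree` supplies
-- `E ⊆ A`, without which the later conjuncts could not be read in the framework.
×-cong-⇔ : ∀ {A B C D : Set} → A ⇔ B → (B → C ⇔ D) → (A × C) ⇔ (B × D)
×-cong-⇔ A⇔B C⇔D = mk⇔
  (λ (a , c) → let b = to A⇔B a in b , to (C⇔D b) c)
  (λ (b , d) → from A⇔B b , from (C⇔D b) d)

→-cong-⇔ : ∀ {A B C D : Set} → A ⇔ B → (B → C ⇔ D) → (A → C) ⇔ (B → D)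
→-cong-⇔ A⇔B C⇔D = mk⇔
  (λ f b → to (C⇔D b) (f (from A⇔B b)))
  (λ f a → from (C⇔D (to A⇔B a)) (f (to A⇔B a)))

⊨-⋀⇒ : ∀ (φ ψ : Fin n → Formula n) v →
       (v ⊨ ⋀ (λ x → φ x ⇒ ψ x)) ⇔ (∀ x → v ⊨ φ x → v ⊨ ψ x)
⊨-⋀⇒ φ ψ v = ∀-cong-⇔ (λ x → ⊨-⇒ (φ x) (ψ x) v) ⇔-∘ ⊨-⋀ (λ x → φ x ⇒ ψ x) v

-- Sets of arguments stored in valuations

∈⇔lookup : ∀ {x : Fin n} A → x ∈ A ⇔ T (lookup A x)
∈⇔lookup {x = x} A = mk⇔
  (λ x∈A → from T-≡ ([]=⇒lookup x∈A)) (λ t → lookup⇒[]= x A (to T-≡ t))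

-- The family `ℓ` is a parameter because `inn` stores the current set, `inn′` its saved copy, and
-- `aw` the present arguments.
Labels : (Fin n → Prp n) → Valuation n → Subset n → Set
Labels ℓ v E = ∀ x → T (v (ℓ x)) ⇔ x ∈ E

labelled : (Fin n → Prp n) → Valuation n → Subset n
labelled ℓ v = Vec.tabulate (v ∘ ℓ)

Labels-labelled : ∀ ℓ (v : Valuation n) → Labels ℓ v (labelled ℓ v)
Labels-labelled ℓ v x = ⇔-sym (∈⇔lookup _) ⇔-∘
  mk⇔ (subst T (sym eq)) (subst T eq)
  where
  eq : lookup (labelled ℓ v) x ≡ v (ℓ x)
  eq = lookup∘tabulate (v ∘ ℓ) x

Labels-resp : ∀ {ℓ ℓ′ : Fin n → Prp n} → (∀ x → w (ℓ′ x) ≡ v (ℓ x)) → Labels ℓ v E → Labels ℓ′ w E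
Labels-resp w≡v L x = subst (λ b → T b ⇔ _) (sym (w≡v x)) (L x)

inn∈IN : ∀ (x : Fin n) → inn x ∈ˡ IN
inn∈IN x = ∈-map⁺ inn (∈-allFin x)

Agree-IN : (∀ x → w (aw x) ≡ v (aw x)) → (∀ x y → w (r x y) ≡ v (r x y)) →
           (∀ x → w (inn′ x) ≡ v (inn′ x)) → (∀ k → w (other k) ≡ v (other k)) →
           Agree IN v w
Agree-IN a b c d (aw x)    _  = sym (a x)
Agree-IN a b c d (inn x)   p∉ = contradiction (inn∈IN x) p∉
Agree-IN a b c d (inn′ x)  _  = sym (c x)
Agree-IN a b c d (r x y)   _  = sym (b x y)
Agree-IN a b c d (other k) _  = sym (d k)

relabel : Subset n → Valuation n → Valuation n
relabel E v (inn x)   = lookup E x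
relabel E v (aw x)    = v (aw x)
relabel E v (inn′ x)  = v (inn′ x)
relabel E v (r x y)   = v (r x y)
relabel E v (other k) = v (other k)

Agree-relabel : ∀ E (v : Valuation n) → Agree IN v (relabel E v)
Agree-relabel E v = Agree-IN (λ _ → refl) (λ _ _ → refl) (λ _ → refl) (λ _ → refl)

Labels-relabel : ∀ E (v : Valuation n) → Labels inn (relabel E v) E
Labels-relabel E v x = ⇔-sym (∈⇔lookup E)

IN-inv : p ∈ˡ IN → ∃ λ x → p ≡ inn x
IN-inv p∈ with ∈-map⁻ inn p∈
... | x , _ , p≡ = x , p≡

Agree-IN-aw : Agree IN v w → ∀ x → w (aw x) ≡ v (aw x)
Agree-IN-aw v~w x = sym (v~w (aw x) (λ p∈ → case IN-inv p∈ of λ ()))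

Agree-IN-r : Agree IN v w → ∀ x y → w (r x y) ≡ v (r x y)
Agree-IN-r v~w x y = sym (v~w (r x y) (λ p∈ → case IN-inv p∈ of λ ()))

Agree-IN-inn′ : Agree IN v w → ∀ x → w (inn′ x) ≡ v (inn′ x)
Agree-IN-inn′ v~w x = sym (v~w (inn′ x) (λ p∈ → case IN-inv p∈ of λ ()))

⟦makeExtOf⟧ : ∀ φ → ⟦ makeExtOf φ ⟧ v w ⇔ (Agree IN v w × (w ⊨ φ))
⟦makeExtOf⟧ {v = v} {w} φ = mk⇔
  (λ (u , vu , w≐u , u⊨φ) → let w≈u = ≐⇒≈ w≐u in
    Agree-trans (to ⟦vary⟧ vu) (λ p _ → sym (w≈u p)) , ⊨-resp-≈ φ (≈-sym w≈u) u⊨φ)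
  (λ (v~w , w⊨φ) → w , from ⟦vary⟧ v~w , ≈⇒≐ ≈-refl , w⊨φ)

Strictly-IN : ∀ b → Strictly b IN v w ⇔
  (Agree IN v w × (∀ x → v (inn x) ≡ b → w (inn x) ≡ b) ×
   ∃ λ x → v (inn x) ≡ Bool.not b × w (inn x) ≡ b)
Strictly-IN {n} {v} {w} b = mk⇔ unfold fold
  where
  unfold : Strictly b IN v w →
    Agree IN v w × (∀ x → v (inn x) ≡ b → w (inn x) ≡ b) ×
    ∃ λ x → v (inn x) ≡ Bool.not b × w (inn x) ≡ b
  unfold (v⇝w , p , p∈ , vp , wp) with IN-inv p∈
  ... | x , refl =
    (λ q q∉ → Sum.[ id , (λ (q∈ , _) → contradiction q∈ q∉) ] (v⇝w q)) ,
    (λ y → Assigns-preserves v⇝w (inn y)) , x , vp , wp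

  fold : Agree IN v w × (∀ x → v (inn x) ≡ b → w (inn x) ≡ b) ×
    (∃ λ x → v (inn x) ≡ Bool.not b × w (inn x) ≡ b) → Strictly b IN v w
  fold (v~w , mono , x , vx , wx) = v⇝w , inn x , inn∈IN x , vx , wx
    where
    v⇝w : Assigns b (_∈ˡ IN) v w
    v⇝w p with p ∈ˡ? IN
    ... | no p∉ = inj₁ (v~w p p∉)
    ... | yes p∈ with IN-inv p∈ | w p Bool.≟ b
    ...   | _        | yes wp≡b = inj₂ (p∈ , wp≡b)
    -- By monotonicity `v` cannot have the value `b` here either, so both values are `not b`.
    ...   | y , refl | no  wp≢b = inj₁ (trans (Bool.¬-not (wp≢b ∘ mono y)) (sym (Bool.¬-not wp≢b)))

T⇔⇒≡false : ∀ {b} {A : Set} → T b ⇔ A → b ≡ false ⇔ (¬ A)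
T⇔⇒≡false e = ¬-cong-⇔ e ⇔-∘ mk⇔
  (λ { refl () }) (λ ¬t → Bool.¬-not (¬t ∘ from T-≡))

T⇔⇒≡true : ∀ {b} {A : Set} → T b ⇔ A → b ≡ true ⇔ A
T⇔⇒≡true e = e ⇔-∘ ⇔-sym T-≡

Strictly-true : Labels inn v E → Labels inn w E′ → Strictly true IN v w ⇔ (Agree IN v w × E ⊂ E′)
Strictly-true Lv Lw = mk⇔
  (λ (v~w , mono , x , vx , wx) → v~w ,
    (λ {y} → to (T⇔⇒≡true (Lw y)) ∘ mono y ∘ from (T⇔⇒≡true (Lv y))) ,
    x , to (T⇔⇒≡true (Lw x)) wx , to (T⇔⇒≡false (Lv x)) vx)
  (λ (v~w , E⊆E′ , x , x∈ , x∉) → v~w ,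
    (λ y → from (T⇔⇒≡true (Lw y)) ∘ E⊆E′ ∘ to (T⇔⇒≡true (Lv y))) ,
    x , from (T⇔⇒≡false (Lv x)) x∉ , from (T⇔⇒≡true (Lw x)) x∈)
  ⇔-∘ Strictly-IN true

Strictly-false : Labels inn v E → Labels inn w E′ → Strictly false IN v w ⇔ (Agree IN v w × E′ ⊂ E)
Strictly-false {E = E} Lv Lw = mk⇔
  (λ (v~w , mono , x , vx , wx) → v~w ,
    -- Here monotonicity says that what is outside `E` stays outside; the inclusion is its
    -- contrapositive.
    (λ {y} y∈E′ → decidable-stable (y ∈? E) (λ y∉E →
      to (T⇔⇒≡false (Lw y)) (mono y (from (T⇔⇒≡false (Lv y)) y∉E)) y∈E′)) ,
    x , to (T⇔⇒≡true (Lv x)) vx , to (T⇔⇒≡false (Lw x)) wx)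
  (λ (v~w , E′⊆E , x , x∈ , x∉) → v~w ,
    (λ y vy → from (T⇔⇒≡false (Lw y)) (to (T⇔⇒≡false (Lv y)) vy ∘ E′⊆E)) ,
    x , from (T⇔⇒≡true (Lv x)) x∈ , from (T⇔⇒≡false (Lw x)) x∉)
  ⇔-∘ Strictly-IN false

-- Over an empty universe `mkTrueOne IN` would be `skip`, and a run of `strictlyLarger` would not
-- have to enlarge anything.
IN-nonempty : .{{_ : NonZero n}} → ∃ λ p → p ∈ˡ IN {n}
IN-nonempty {ℕ.suc n} = inn zero , inn∈IN zero

⟦strictlyLarger⟧ : .{{_ : NonZero n}} → ∀ {v w : Valuation n} → Labels inn v E → Labels inn w E′ →
  ⟦ strictlyLarger ⟧ v w ⇔ (Agree IN v w × E ⊂ E′)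
⟦strictlyLarger⟧ Lv Lw = Strictly-true Lv Lw ⇔-∘ ⟦strictly⟧ true (proj₂ IN-nonempty)

⟦strictlySmaller⟧ : .{{_ : NonZero n}} → ∀ {v w : Valuation n} → Labels inn v E → Labels inn w E′ →
  ⟦ strictlySmaller ⟧ v w ⇔ (Agree IN v w × E′ ⊂ E)
⟦strictlySmaller⟧ Lv Lw = Strictly-false Lv Lw ⇔-∘ ⟦strictly⟧ false (proj₂ IN-nonempty)

-- Admissible, complete and preferred sets

module _ (F : AF n) where
  open AF F

  complete⇒admissible : IsComplete F E → IsAdmissible F E
  complete⇒admissible (cf@(E⊆A , _) , E⇔) = cf , λ a a∈E → to (E⇔ a (E⊆A a∈E)) a∈E

  ⁺-mono : E ⊆ E′ → ∀ {x} → _⁺ F E x → _⁺ F E′ x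
  ⁺-mono E⊆E′ (x∈A , y , y∈E , yx) = x∈A , y , E⊆E′ y∈E , yx

  conflictFree-⊆ : E ⊆ E′ → IsConflictFree F E′ → IsConflictFree F E
  conflictFree-⊆ E⊆E′ (E′⊆A , free) =
    E′⊆A ∘ E⊆E′ , λ x (x∈E , x∈E⁺) → free x (E⊆E′ x∈E , ⁺-mono E⊆E′ x∈E⁺)

  -- Dung's fundamental lemma.
  admissible-∪ : ∀ {a} → IsAdmissible F E → a ∈ A → Defends F E a → IsAdmissible F (E ∪ ⁅ a ⁆)
  admissible-∪ {E = E} {a = a} ((E⊆A , free) , def) a∈A Ea =
    (E′⊆A , free′) , λ x x∈ y y∈A yx → ⁺-mono E⊆E′ (E-defends x∈ y y∈A yx)
    where
    E⊆E′ : E ⊆ E ∪ ⁅ a ⁆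
    E⊆E′ = p⊆p∪q ⁅ a ⁆

    E-defends : ∀ {x} → x ∈ E ∪ ⁅ a ⁆ → Defends F E x
    E-defends x∈ with x∈p∪q⁻ E ⁅ a ⁆ x∈
    ... | inj₁ x∈E = def _ x∈E
    ... | inj₂ x∈a with x∈⁅y⁆⇒x≡y a x∈a
    ...   | refl = Ea

    E′⊆A : E ∪ ⁅ a ⁆ ⊆ A
    E′⊆A x∈ with x∈p∪q⁻ E ⁅ a ⁆ x∈
    ... | inj₁ x∈E = E⊆A x∈E
    ... | inj₂ x∈a with x∈⁅y⁆⇒x≡y a x∈a
    ...   | refl = a∈A

    free′ : ∀ x → ¬ (x ∈ E ∪ ⁅ a ⁆ × _⁺ F (E ∪ ⁅ a ⁆) x)
    -- Two rounds of defence: `E` defends `x`, so some `z` in `E` attacks `y`; but `E` defends `y`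
    -- too, so `E` attacks `z`, a conflict inside `E`.
    free′ x (x∈ , _ , y , y∈ , yx) with E-defends x∈ y (E′⊆A y∈) yx
    ... | _ , z , z∈E , zy = free z (z∈E , E-defends y∈ z (E⊆A z∈E) zy)

  ∪-⊂ : ∀ {a} → a ∉ E → E ⊂ E ∪ ⁅ a ⁆
  ∪-⊂ {E = E} {a = a} a∉E = p⊆p∪q ⁅ a ⁆ , a , x∈p∪q⁺ (inj₂ (x∈⁅x⁆ a)) , a∉E

  -- An argument that is defended but missing could be added by the fundamental lemma, contradicting
  -- maximality.
  maximalAdmissible⇒complete : Maximal (IsAdmissible F) E → IsComplete F E
  maximalAdmissible⇒complete {E = E} (adm@(cf , def) , max) = cf , λ a a∈A → mk⇔ (def a)
    (λ Ea → decidable-stable (a ∈? E) (λ a∉E → max _ (admissible-∪ adm a∈A Ea) (∪-⊂ a∉E)))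

  -- Induction from the larger sets downwards. An admissible set above `E′` would also lie above
  -- `E`, which the induction hypothesis forbids; so `E′` is maximal admissible, hence complete,
  -- against the maximality of `E` among complete sets.
  maximalComplete⇒maximalAdmissible : Maximal (IsComplete F) E → Maximal (IsAdmissible F) E
  maximalComplete⇒maximalAdmissible {E = E} (com , max) =
    complete⇒admissible com , λ E′ → no-larger E′ (⊃-wellFounded E′)
    where
    no-larger : ∀ E′ → Acc Subset._⊃_ E′ → IsAdmissible F E′ → ¬ (E ⊂ E′)
    no-larger E′ (acc rec) adm E⊂E′ =
      max E′ (maximalAdmissible⇒complete (adm , λ E″ adm″ E′⊂E″ →
        no-larger E″ (rec E′⊂E″) adm″ (⊂-⊆-trans E⊂E′ (proj₁ E′⊂E″)))) E⊂E′

  maximalAdmissible⇔preferred : Maximal (IsAdmissible F) E ⇔ IsPreferred F E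
  maximalAdmissible⇔preferred = mk⇔
    (λ maxAdm@(_ , max) → maximalAdmissible⇒complete maxAdm ,
      λ E′ com → max E′ (complete⇒admissible com))
    maximalComplete⇒maximalAdmissible

-- Formulas expressing the semantics

attacked range : (Fin n → Prp n) → Fin n → Formula n
attacked ℓ x = ⋁ λ y → var (ℓ y) ∧ var (r y x)
range    ℓ x = var (ℓ x) ∨ (var (aw x) ∧ attacked ℓ x)

-- Attack variables with an absent end are left free, because runs leave some of them on, for
-- instance the control attacks of arguments that were not selected.
record Encodes (v : Valuation n) (F : AF n) : Set where
  open AF F
  field
    arguments : ∀ x → T (v (aw x)) ⇔ x ∈ A
    attacks   : ∀ {x y} → x ∈ A → y ∈ A → T (v (r x y)) ⇔ (x , y) ∈ʳ R

module _ {F : AF n} where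
  open AF F
  open Encodes

  Encodes-resp : (∀ x → w (aw x) ≡ v (aw x)) → (∀ x y → w (r x y) ≡ v (r x y)) →
                 Encodes v F → Encodes w F
  Encodes-resp {w = w} {v = v} aw≡ r≡ enc = record
    { arguments = λ x → subst (λ b → T b ⇔ x ∈ A) (sym (aw≡ x)) (arguments enc x)
    ; attacks   = λ {x} {y} x∈A y∈A →
        subst (λ b → T b ⇔ (x , y) ∈ʳ R) (sym (r≡ x y)) (attacks enc x∈A y∈A)
    }

  Encodes-Agree : Agree IN v w → Encodes v F → Encodes w F
  Encodes-Agree v~w = Encodes-resp (Agree-IN-aw v~w) (Agree-IN-r v~w)

  ⊨-attacked : ∀ {ℓ} → Encodes v F → Labels ℓ v E → E ⊆ A → ∀ {x} → x ∈ A →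
    (v ⊨ attacked ℓ x) ⇔ _⁺ F E x
  ⊨-attacked {v = v} {ℓ = ℓ} enc L E⊆A {x} x∈A = mk⇔
    (λ (y , y∈E , yx) → let y∈ = to (L y) y∈E in
      x∈A , y , y∈ , to (attacks enc (E⊆A y∈) x∈A) yx)
    (λ (_ , y , y∈E , yx) → y , from (L y) y∈E , from (attacks enc (E⊆A y∈E) x∈A) yx)
    ⇔-∘ ⊨-⋁ (λ y → var (ℓ y) ∧ var (r y x)) v

-- The equivalence ranges over all encodings of `F`, so it can be applied again at the successors
-- visited by a modality inside a larger formula.
record Expresses (F : AF n) (φ : Formula n) (S : Pred (Subset n) 0ℓ) : Set where
  field
    holds⇔ : ∀ v E → Encodes v F → Labels inn v E → (v ⊨ φ) ⇔ S E

open Expresses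

module _ {F : AF n} where
  open AF F
  open Encodes

  expresses-Well : Expresses F Well (_⊆ A)
  expresses-Well .holds⇔ v E enc L = mk⇔
    (λ h {x} → to (arguments enc x) ∘ h x ∘ from (L x))
    (λ E⊆A x → from (arguments enc x) ∘ E⊆A ∘ to (L x))
    ⇔-∘ ⊨-⋀⇒ (var ∘ inn) (var ∘ aw) v

  expresses-ConFree : Expresses F ConFree (IsConflictFree F)
  expresses-ConFree .holds⇔ v E enc L = ×-cong-⇔ (holds⇔ expresses-Well v E enc L) λ E⊆A →
    mk⇔
      (λ h x (x∈E , _ , y , y∈E , yx) → h y x
        (from (L y) y∈E , from (L x) x∈E , from (attacks enc (E⊆A y∈E) (E⊆A x∈E)) yx))
      (λ free x y (x∈E , y∈E , xy) → let x∈ = to (L x) x∈E ; y∈ = to (L y) y∈E in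
        free y (y∈ , E⊆A y∈ , x , x∈ , to (attacks enc (E⊆A x∈) (E⊆A y∈)) xy))
    ⇔-∘ (∀-cong-⇔ (λ x → ⊨-⋀ (clash x) v) ⇔-∘ ⊨-⋀ (λ x → ⋀ (clash x)) v)
    where
    clash : Fin n → Fin n → Formula n
    clash x y = ∼ (var (inn x) ∧ var (inn y) ∧ var (r x y))

  ⊨-Defended : Encodes v F → Labels inn v E → E ⊆ A → ∀ {x} → x ∈ A →
    (v ⊨ Defended x) ⇔ Defends F E x
  ⊨-Defended {v = v} enc L E⊆A {x} x∈A = mk⇔
    (λ h y y∈A yx → to (⊨-attacked enc L E⊆A y∈A)
      (h y (from (arguments enc y) y∈A , from (attacks enc y∈A x∈A) yx)))
    (λ def y (y∈ , yx) → let y∈A = to (arguments enc y) y∈ in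
      from (⊨-attacked enc L E⊆A y∈A) (def y y∈A (to (attacks enc y∈A x∈A) yx)))
    ⇔-∘ ⊨-⋀⇒ (λ y → var (aw y) ∧ var (r y x)) (attacked inn) v

  expresses-Admissible : Expresses F Admissible (IsAdmissible F)
  expresses-Admissible .holds⇔ v E enc L =
    ×-cong-⇔ (holds⇔ expresses-ConFree v E enc L) λ (E⊆A , _) →
    ∀-cong-⇔ (λ x → →-cong-⇔ (L x) (λ x∈E → ⊨-Defended enc L E⊆A (E⊆A x∈E)))
    ⇔-∘ ⊨-⋀⇒ (var ∘ inn) Defended v

  expresses-Complete : Expresses F Complete (IsComplete F)
  expresses-Complete .holds⇔ v E enc L =
    ×-cong-⇔ (holds⇔ expresses-ConFree v E enc L) λ (E⊆A , _) →
    ∀-cong-⇔ (λ x → →-cong-⇔ (arguments enc x) (λ x∈A →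
      let D⇔ = ⊨-Defended enc L E⊆A x∈A in
      mk⇔ (λ e → D⇔ ⇔-∘ (e ⇔-∘ ⇔-sym (L x))) (λ e → ⇔-sym D⇔ ⇔-∘ (e ⇔-∘ L x))
      ⇔-∘ ⊨-↔ (var (inn x)) (Defended x) v))
    ⇔-∘ ⊨-⋀⇒ (var ∘ aw) (λ x → var (inn x) ↔ Defended x) v

  expresses-Stable : Expresses F Stable (IsStable F)
  expresses-Stable .holds⇔ v E enc L = mk⇔ sound complete ⇔-∘
    ×-cong-⇔ (holds⇔ expresses-Well v E enc L) λ E⊆A →
    ∀-cong-⇔ (λ x → →-cong-⇔ (arguments enc x) (λ x∈A →
      let D⇔ = ¬-cong-⇔ (⊨-attacked enc L E⊆A x∈A) in
      mk⇔ (λ e → D⇔ ⇔-∘ (e ⇔-∘ ⇔-sym (L x))) (λ e → ⇔-sym D⇔ ⇔-∘ (e ⇔-∘ L x))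
      ⇔-∘ ⊨-↔ (var (inn x)) (∼ attacked inn x) v))
    ⇔-∘ ⊨-⋀⇒ (var ∘ aw) (λ x → var (inn x) ↔ ∼ attacked inn x) v
    where
    Criterion : Set
    Criterion = E ⊆ A × ∀ x → x ∈ A → x ∈ E ⇔ (¬ _⁺ F E x)

    sound : Criterion → IsStable F E
    sound (E⊆A , E⇔) = (E⊆A , λ x (x∈E , x∈E⁺) → to (E⇔ x (E⊆A x∈E)) x∈E x∈E⁺) , λ x x∈A x∉E →
      let att⇔ = ⊨-attacked enc L E⊆A x∈A in
      -- The biconditional yields `E ⁺` only doubly negated; the double negation is removed on the
      -- formula, whose truth is decidable.
      to att⇔ (decidable-stable (v ⊨? attacked inn x)
        (λ ¬att → x∉E (from (E⇔ x x∈A) (¬att ∘ from att⇔))))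

    complete : IsStable F E → Criterion
    complete ((E⊆A , free) , all) = E⊆A , λ x x∈A → mk⇔
      (λ x∈E x∈E⁺ → free x (x∈E , x∈E⁺))
      (λ x∉E⁺ → decidable-stable (x ∈? E) (λ x∉E → x∉E⁺ (all x x∈A x∉E)))

  makeExtOf-sound : ∀ {φ S} → Expresses F φ S → Encodes v F →
    ⟦ makeExtOf φ ⟧ v w → S (labelled inn w)
  makeExtOf-sound {w = w} {φ = φ} ex enc vw with to (⟦makeExtOf⟧ φ) vw
  ... | v~w , w⊨φ = to (holds⇔ ex w _ (Encodes-Agree v~w enc) (Labels-labelled inn w)) w⊨φ

  makeExtOf-complete : ∀ {φ S} → Expresses F φ S → Encodes v F →
    S E → ⟦ makeExtOf φ ⟧ v (relabel E v)
  makeExtOf-complete {v = v} {E = E} {φ = φ} ex enc SE = from (⟦makeExtOf⟧ φ)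
    (Agree-relabel E v ,
     from (holds⇔ ex _ E (Encodes-Agree (Agree-relabel E v) enc) (Labels-relabel E v)) SE)

  module _ {φ : Formula n} {S : Pred (Subset n) 0ℓ} (ex : Expresses F φ S) where

    -- Competing sets and successors correspond: `E′` gives the successor `relabel E′ v`, and a
    -- successor `w` gives the set `labelled inn w`. Nothing outside `IN` changes, so both
    -- valuations still encode `F`.
    expresses-Maximal : .{{_ : NonZero n}} → Expresses F (φ ∧ [ strictlyLarger ] ∼ φ) (Maximal S)
    expresses-Maximal .holds⇔ v E enc L = ×-cong-⇔ (holds⇔ ex v E enc L) λ _ → mk⇔
      (λ h E′ SE′ E⊂E′ →
        let v~w = Agree-relabel E′ v ; Lw = Labels-relabel E′ v in
        h (relabel E′ v) (from (⟦strictlyLarger⟧ L Lw) (v~w , E⊂E′))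
          (from (holds⇔ ex _ E′ (Encodes-Agree v~w enc) Lw) SE′))
      (λ max w vw w⊨φ →
        let Lw = Labels-labelled inn w ; (v~w , E⊂E′) = to (⟦strictlyLarger⟧ L Lw) vw in
        max (labelled inn w) (to (holds⇔ ex w _ (Encodes-Agree v~w enc) Lw) w⊨φ) E⊂E′)

    expresses-Minimal : .{{_ : NonZero n}} → Expresses F (φ ∧ [ strictlySmaller ] ∼ φ) (Minimal S)
    expresses-Minimal .holds⇔ v E enc L = ×-cong-⇔ (holds⇔ ex v E enc L) λ _ → mk⇔
      (λ h E′ SE′ E′⊂E →
        let v~w = Agree-relabel E′ v ; Lw = Labels-relabel E′ v in
        h (relabel E′ v) (from (⟦strictlySmaller⟧ L Lw) (v~w , E′⊂E))
          (from (holds⇔ ex _ E′ (Encodes-Agree v~w enc) Lw) SE′))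
      (λ min w vw w⊨φ →
        let Lw = Labels-labelled inn w ; (v~w , E′⊂E) = to (⟦strictlySmaller⟧ L Lw) vw in
        min (labelled inn w) (to (holds⇔ ex w _ (Encodes-Agree v~w enc) Lw) w⊨φ) E′⊂E)

    -- The common form of ideal sets (`φ` preferred) and eager sets (`φ` semi-stable).
    expresses-AdmissibleIn : Expresses F
      (Admissible ∧ ⋀ (λ x → var (inn x) ⇒ [ makeExtOf φ ] var (inn x)))
      (λ E → IsAdmissible F E × (∀ E′ → S E′ → E ⊆ E′))
    expresses-AdmissibleIn .holds⇔ v E enc L =
      ×-cong-⇔ (holds⇔ expresses-Admissible v E enc L) λ _ →
      mk⇔
        (λ h E′ SE′ {x} x∈E → to (Labels-relabel E′ v x)
          (h x (from (L x) x∈E) (relabel E′ v) (makeExtOf-complete ex enc SE′)))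
        (λ h x x∈E w vw → from (Labels-labelled inn w x)
          (h (labelled inn w) (makeExtOf-sound ex enc vw) (to (L x) x∈E)))
      ⇔-∘ ⊨-⋀⇒ (var ∘ inn) (λ x → [ makeExtOf φ ] var (inn x)) v

    module _ (S⇒⊆A : ∀ E → S E → E ⊆ A) where

      ⊨-range : ∀ {ℓ v E} → Encodes v F → Labels ℓ v E → E ⊆ A → ∀ x →
        (v ⊨ range ℓ x) ⇔ _⊕ F E x
      ⊨-range {ℓ} {v} enc L E⊆A x = (L x ⊎-⇔
        (mk⇔ (λ (x∈A , x∈E⁺) → x∈E⁺) (λ x∈E⁺ → proj₁ x∈E⁺ , x∈E⁺)
         ⇔-∘ ×-cong-⇔ (arguments enc x) (⊨-attacked enc L E⊆A)))
        ⇔-∘ ⊨-∨ (var (ℓ x)) (var (aw x) ∧ attacked ℓ x) v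

      ⊨-includes : ∀ {ℓ ℓ′ v E E′} → Encodes v F → Labels ℓ v E → Labels ℓ′ v E′ → E ⊆ A → E′ ⊆ A →
        (v ⊨ ⋀ (λ x → range ℓ x ⇒ range ℓ′ x)) ⇔
        (_⊕ F E Pred.⊆ _⊕ F E′)
      ⊨-includes {ℓ} {ℓ′} {v} enc L L′ E⊆A E′⊆A = mk⇔
        (λ h {x} → to (⊨-range enc L′ E′⊆A x) ∘ h x ∘ from (⊨-range enc L E⊆A x))
        (λ h x → from (⊨-range enc L′ E′⊆A x) ∘ h ∘ to (⊨-range enc L E⊆A x))
        ⇔-∘ ⊨-⋀⇒ (range ℓ) (range ℓ′) v

      -- The common form of semi-stable and stage. `copyIN` saves `E` in the primed variables, which
      -- `vary IN` does not touch; afterwards `inn′` labels `E` and `inn` its competitor, and `Rg′`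
      -- and `Rg` (that is, `range inn′` and `range inn`) compare their ranges in one valuation.
      expresses-rangeMaximal : Expresses F
        (φ ∧ [ copyIN ⨾ makeExtOf φ ] (IncludesCp ⇒ IncludedInCp))
        (λ E → S E × (∀ E′ → S E′ → ¬ (_⊕ F E Pred.⊂ _⊕ F E′)))
      expresses-rangeMaximal .holds⇔ v E enc L =
        ×-cong-⇔ (holds⇔ ex v E enc L) λ SE → mk⇔ (sound SE) (complete SE)
        where
        encᶜ : Encodes (copied v) F
        encᶜ = Encodes-resp (λ _ → refl) (λ _ _ → refl) enc

        sound : S E → v ⊨ [ copyIN ⨾ makeExtOf φ ] (IncludesCp ⇒ IncludedInCp) →
                ∀ E′ → S E′ → ¬ (_⊕ F E Pred.⊂ _⊕ F E′)
        sound SE h E′ SE′ (E⊆E′ , E′⊈E) =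
          -- As `φ ⇒ ψ` abbreviates `∼ (φ ∧ ∼ ψ)`, the box is refuted by exactly the two halves of
          -- the strict inclusion.
          h t (copied v , from (⟦copyIN⟧ {v = v}) ≈-refl , makeExtOf-complete ex encᶜ SE′)
            (from (⊨-includes encʷ L′ Lʷ E⊆A E′⊆A) E⊆E′ ,
             E′⊈E ∘ to (⊨-includes encʷ Lʷ L′ E′⊆A E⊆A))
          where
          t : Valuation n
          t = relabel E′ (copied v)

          encʷ : Encodes t F
          encʷ = Encodes-Agree (Agree-relabel E′ (copied v)) encᶜ

          E⊆A : E ⊆ A
          E⊆A = S⇒⊆A E SE

          E′⊆A : E′ ⊆ A
          E′⊆A = S⇒⊆A E′ SE′

          Lʷ : Labels inn t E′
          Lʷ = Labels-relabel E′ (copied v)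

          L′ : Labels inn′ t E
          L′ = Labels-resp {w = t} {v = v} {ℓ = inn} {ℓ′ = inn′} (λ _ → refl) L

        complete : S E → (∀ E′ → S E′ → ¬ (_⊕ F E Pred.⊂ _⊕ F E′)) →
                   v ⊨ [ copyIN ⨾ makeExtOf φ ] (IncludesCp ⇒ IncludedInCp)
        complete SE max w (u , vu , uw) (includes , ¬included) =
          max D SD (to (⊨-includes encʷ L′ Lʷ E⊆A D⊆A) includes ,
            ¬included ∘ from (⊨-includes encʷ Lʷ L′ D⊆A E⊆A))
          where
          u≈ : u ≈ copied v
          u≈ = to ⟦copyIN⟧ vu

          encᵘ : Encodes u F
          encᵘ = Encodes-resp (λ x → u≈ (aw x)) (λ x y → u≈ (r x y)) encᶜ

          u~w : Agree IN u w
          u~w = proj₁ (to (⟦makeExtOf⟧ φ) uw)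

          encʷ : Encodes w F
          encʷ = Encodes-Agree u~w encᵘ

          D : Subset n
          D = labelled inn w

          SD : S D
          SD = makeExtOf-sound ex encᵘ uw

          E⊆A : E ⊆ A
          E⊆A = S⇒⊆A E SE

          D⊆A : D ⊆ A
          D⊆A = S⇒⊆A D SD

          Lʷ : Labels inn w D
          Lʷ = Labels-labelled inn w

          L′ : Labels inn′ w E
          L′ = Labels-resp {w = w} {v = v} {ℓ = inn} {ℓ′ = inn′}
            (λ x → trans (Agree-IN-inn′ u~w x) (u≈ (inn′ x))) L

  module _ .{{_ : NonZero n}} where

    expresses-Preferred : Expresses F Preferred (IsPreferred F)
    expresses-Preferred .holds⇔ v E enc L =
      maximalAdmissible⇔preferred F ⇔-∘ holds⇔ (expresses-Maximal expresses-Admissible) v E enc L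

    Labels-∪ : ∀ {v w x} → Labels inn v E → w ≈ update (inn x) true v → Labels inn w (E ∪ ⁅ x ⁆)
    Labels-∪ {E = E} {v} {w} {x} L w≈ y with inn x ≟ inn y | w≈ (inn y)
    ... | yes refl | wy = mk⇔ (λ _ → x∈p∪q⁺ (inj₂ (x∈⁅x⁆ x))) (λ _ → from T-≡ wy)
    ... | no x≢y   | wy = subst (λ b → T b ⇔ y ∈ E ∪ ⁅ x ⁆) (sym wy) (mk⇔
      (x∈p∪q⁺ ∘ inj₁) shrink ⇔-∘ L y)
      where
      shrink : y ∈ E ∪ ⁅ x ⁆ → y ∈ E
      shrink y∈ with x∈p∪q⁻ E ⁅ x ⁆ y∈
      ... | inj₁ y∈E = y∈E
      ... | inj₂ y∈x = contradiction (cong inn (sym (x∈⁅y⁆⇒x≡y x y∈x))) x≢y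

    Encodes-update : ∀ {v w x b} → w ≈ update (inn x) b v → Encodes v F → Encodes w F
    Encodes-update {v} {b = b} w≈ = Encodes-resp
      (λ y → trans (w≈ (aw y)) (update-≢ b v λ ()))
      (λ y z → trans (w≈ (r y z)) (update-≢ b v λ ()))

    -- One added argument suffices, conflict-freeness being hereditary.
    expresses-Naive : Expresses F Naive (IsNaive F)
    expresses-Naive .holds⇔ v E enc L =
      ×-cong-⇔ (holds⇔ expresses-ConFree v E enc L) λ _ → mk⇔ sound complete
      where
      sound : v ⊨ [ mkTrueOne IN ] ∼ ConFree → ∀ E′ → IsConflictFree F E′ → ¬ (E ⊂ E′)
      sound h E′ cf (E⊆E′ , x , x∈E′ , x∉E) = h t
        (from (⟦mkOne⟧ true (proj₂ IN-nonempty))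
          (inn x , inn∈IN x , from (T⇔⇒≡false (L x)) x∉E , ≈-refl))
        (from (holds⇔ expresses-ConFree t _ (Encodes-update ≈-refl enc) (Labels-∪ {v = v} L ≈-refl))
          (conflictFree-⊆ F E∪x⊆E′ cf))
        where
        t : Valuation n
        t = update (inn x) true v

        E∪x⊆E′ : E ∪ ⁅ x ⁆ ⊆ E′
        E∪x⊆E′ y∈ with x∈p∪q⁻ E ⁅ x ⁆ y∈
        ... | inj₁ y∈E = E⊆E′ y∈E
        ... | inj₂ y∈x with x∈⁅y⁆⇒x≡y x y∈x
        ...   | refl = x∈E′

      complete : (∀ E′ → IsConflictFree F E′ → ¬ (E ⊂ E′)) → v ⊨ [ mkTrueOne IN ] ∼ ConFree
      complete max w vw w⊨ with to (⟦mkOne⟧ true (proj₂ IN-nonempty)) vw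
      ... | q , q∈ , vq , w≈ with IN-inv q∈
      ...   | x , refl = max (E ∪ ⁅ x ⁆)
        (to (holds⇔ expresses-ConFree w _ (Encodes-update w≈ enc) (Labels-∪ L w≈)) w⊨)
        (∪-⊂ F (to (T⇔⇒≡false (L x)) vq))

    expresses-SemiStable : Expresses F SemiStable (IsSemiStable F)
    expresses-SemiStable = expresses-rangeMaximal expresses-Complete (λ E → proj₁ ∘ proj₁)

    expresses-extension : ∀ σ → Expresses F (extensionFormula σ) (Extension σ F)
    expresses-extension st  = expresses-Stable
    expresses-extension co  = expresses-Complete
    expresses-extension gr  = expresses-Minimal expresses-Complete
    expresses-extension pr  = expresses-Preferred
    expresses-extension se  = expresses-SemiStable
    expresses-extension id′ = expresses-Maximal (expresses-AdmissibleIn expresses-Preferred)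
    expresses-extension ea  = expresses-Maximal (expresses-AdmissibleIn expresses-SemiStable)
    expresses-extension na  = expresses-Naive
    expresses-extension stg = expresses-rangeMaximal expresses-ConFree (λ E → proj₁)

-- Control and completion

Assigns-true⁺ : ∀ {S : Pred (Prp n) 0ℓ} → (∀ p → T (v p) → T (w p)) →
                (∀ p → T (w p) → T (v p) ⊎ S p) → Assigns true S v w
Assigns-true⁺ {v = v} {w = w} mono new p with w p Bool.≟ true
... | no wp≢true = inj₁ (T-injective (mk⇔ (mono p) (λ t → contradiction (to T-≡ t) wp≢true)))
... | yes wp≡true with new p (from T-≡ wp≡true)
...   | inj₁ t  = inj₁ (trans (to T-≡ t) (sym wp≡true))
...   | inj₂ Sp = inj₂ (Sp , wp≡true)

Assigns-true-mono : ∀ {S : Pred (Prp n) 0ℓ} → Assigns true S v w → ∀ p → T (v p) → T (w p)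
Assigns-true-mono v⇝w p = from T-≡ ∘ Assigns-preserves v⇝w p ∘ to T-≡

Assigns-true-new : ∀ {S : Pred (Prp n) 0ℓ} → Assigns true S v w → ∀ p → T (w p) → T (v p) ⊎ S p
Assigns-true-new v⇝w p t with v⇝w p
... | inj₁ vp≡wp    = inj₁ (subst T (sym vp≡wp) t)
... | inj₂ (Sp , _) = inj₂ Sp

-- The midpoint takes the value of `w` on `S` and of `v` elsewhere, which is why `S` must be
-- decidable. This fuses the three blocks of `makeComp` into one relation.
Assigns-∪ : ∀ {b} {S S′ : Pred (Prp n) 0ℓ} → Pred.Decidable S →
  (∃ λ u → Assigns b S v u × Assigns b S′ u w) ⇔ Assigns b (S Pred.∪ S′) v w
Assigns-∪ {n} {v} {w} {b} {S} {S′} S? = mk⇔ join split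
  where
  join : (∃ λ u → Assigns b S v u × Assigns b S′ u w) → Assigns b (S Pred.∪ S′) v w
  join (u , vu , uw) = Assigns-trans
    (Sum.map₂ (Product.map₁ inj₁) ∘ vu) (Sum.map₂ (Product.map₁ inj₂) ∘ uw)

  split : Assigns b (S Pred.∪ S′) v w → ∃ λ u → Assigns b S v u × Assigns b S′ u w
  split v⇝w = mid , v⇝mid , mid⇝w
    where
    mid : Valuation n
    mid p = if does (S? p) then w p else v p

    v⇝mid : Assigns b S v mid
    v⇝mid p with S? p | v⇝w p
    ... | no  _  | _               = inj₁ refl
    ... | yes _  | inj₁ vp≡wp      = inj₁ vp≡wp
    ... | yes Sp | inj₂ (_ , wp≡b) = inj₂ (Sp , wp≡b)

    mid⇝w : Assigns b S′ mid w
    mid⇝w p with S? p | v⇝w p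
    ... | yes _  | _                       = inj₁ refl
    ... | no _   | inj₁ vp≡wp              = inj₁ vp≡wp
    ... | no ¬Sp | inj₂ (inj₁ Sp , _)      = contradiction Sp ¬Sp
    ... | no _   | inj₂ (inj₂ S′p , wp≡b)  = inj₂ (S′p , wp≡b)

⊨-[⨾] : ∀ (π ρ : Program n) φ v → (v ⊨ [ π ] [ ρ ] φ) ⇔ (v ⊨ [ π ⨾ ρ ] φ)
⊨-[⨾] π ρ φ v = mk⇔
  (λ h t (u , vu , ut) → h u vu t ut)
  (λ h u vu t ut → h t (u , vu , ut))

⊨-⟨⨾⟩ : ∀ (π ρ : Program n) φ v → (v ⊨ ⟨ π ⟩ ⟨ ρ ⟩ φ) ⇔ (v ⊨ ⟨ π ⨾ ρ ⟩ φ)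
⊨-⟨⨾⟩ π ρ φ v = mk⇔
  (λ h k → h (λ u vu ¬none → ¬none (λ t ut → k t (u , vu , ut))))
  (λ h k → h (λ t (u , vu , ut) t⊨φ → k u vu (λ none → none t ut t⊨φ)))

∈-∪ʳ : ∀ (R S : Attacks n) x y → (x , y) ∈ʳ (R ∪ʳ S) ⇔ ((x , y) ∈ʳ R ⊎ (x , y) ∈ʳ S)
∈-∪ʳ R S x y = T-∨

∈-⊠ : ∀ (A B : Subset n) x y → (x , y) ∈ʳ (A ⊠ B) ⇔ (x ∈ A × y ∈ B)
∈-⊠ A B x y = (⇔-sym (∈⇔lookup A) ×-⇔ ⇔-sym (∈⇔lookup B)) ⇔-∘ T-∧

∈-↾ : ∀ (R : Attacks n) A x y → (x , y) ∈ʳ (R ↾ A) ⇔ ((x , y) ∈ʳ R × x ∈ A × y ∈ A)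
∈-↾ R A x y = (⇔-id _ ×-⇔ ∈-⊠ A A x y) ⇔-∘ T-∧

module _ (caf : CAF n) where
  open CAF caf

  -- The control program moves no attack variable, so all of `Rᶜ` stays on whatever `CFG` is; the
  -- restriction to selected arguments takes effect only when a framework is read off.
  record Configured (CFG : Subset n) (w : Valuation n) : Set where
    field
      arguments : ∀ x → T (w (aw x)) ⇔ (x ∈ Aᶠ ⊎ x ∈ CFG)
      attacks   : ∀ x y → T (w (r x y)) ⇔ (x , y) ∈ʳ (Rᶠ ∪ʳ Rᶜ)

  control-sound : ⟦ control caf ⟧ (valuation caf) w → ∃ λ CFG → CFG ⊆ Aᶜ × Configured CFG w
  -- The present arguments include `Aᶠ`, so the configuration is their control part.
  control-sound {w} vw = labelled aw w ∩ Aᶜ , p∩q⊆q _ Aᶜ , record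
    { arguments = λ x → mk⇔ (arguments⁻ x) (arguments⁺ x)
    ; attacks   = λ x y → mk⇔ (attacks⁻ x y) (Assigns-true-mono v⇝w (r x y))
    }
    where
    v⇝w : Assigns true (_∈ˡ AW Aᶜ) (valuation caf) w
    v⇝w = to (⟦mkSome⟧ true) vw

    arguments⁻ : ∀ x → T (w (aw x)) → x ∈ Aᶠ ⊎ x ∈ labelled aw w ∩ Aᶜ
    arguments⁻ x t with Assigns-true-new v⇝w (aw x) t
    ... | inj₁ x∈ = inj₁ (from (∈⇔lookup Aᶠ) x∈)
    ... | inj₂ p∈ with ∈-AW⁻ Aᶜ p∈
    ...   | _ , x∈Aᶜ , refl = inj₂ (x∈p∩q⁺ (to (Labels-labelled aw w x) t , x∈Aᶜ))

    arguments⁺ : ∀ x → x ∈ Aᶠ ⊎ x ∈ labelled aw w ∩ Aᶜ → T (w (aw x))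
    arguments⁺ x (inj₁ x∈Aᶠ) = Assigns-true-mono v⇝w (aw x) (to (∈⇔lookup Aᶠ) x∈Aᶠ)
    arguments⁺ x (inj₂ x∈)   = from (Labels-labelled aw w x) (proj₁ (x∈p∩q⁻ _ Aᶜ x∈))

    attacks⁻ : ∀ x y → T (w (r x y)) → (x , y) ∈ʳ (Rᶠ ∪ʳ Rᶜ)
    attacks⁻ x y t with Assigns-true-new v⇝w (r x y) t
    ... | inj₁ xy∈ = xy∈
    ... | inj₂ p∈ with ∈-AW⁻ Aᶜ p∈
    ...   | _ , _ , ()

  configured : Subset n → Valuation n
  configured CFG (aw x)    = lookup (Aᶠ ∪ CFG) x
  configured CFG (inn x)   = valuation caf (inn x)
  configured CFG (inn′ x)  = valuation caf (inn′ x)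
  configured CFG (r x y)   = valuation caf (r x y)
  configured CFG (other k) = valuation caf (other k)

  control-complete : ∀ {CFG} → CFG ⊆ Aᶜ → ⟦ control caf ⟧ (valuation caf) (configured CFG)
  control-complete {CFG} CFG⊆Aᶜ = from (⟦mkSome⟧ true) (Assigns-true⁺ mono new)
    where
    mono : ∀ p → T (valuation caf p) → T (configured CFG p)
    mono (aw x)  t = to (∈⇔lookup (Aᶠ ∪ CFG)) (x∈p∪q⁺ (inj₁ (from (∈⇔lookup Aᶠ) t)))
    mono (r x y) t = t

    new : ∀ p → T (configured CFG p) → T (valuation caf p) ⊎ p ∈ˡ AW Aᶜ
    new (r x y) t = inj₁ t
    new (aw x)  t = Sum.map (to (∈⇔lookup Aᶠ)) (∈-AW⁺ Aᶜ ∘ CFG⊆Aᶜ)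
      (x∈p∪q⁻ Aᶠ CFG (from (∈⇔lookup (Aᶠ ∪ CFG)) t))

  Configured-configured : ∀ CFG → Configured CFG (configured CFG)
  Configured-configured CFG = record
    { arguments = λ x → mk⇔ (x∈p∪q⁻ Aᶠ CFG) x∈p∪q⁺ ⇔-∘ ⇔-sym (∈⇔lookup (Aᶠ ∪ CFG))
    ; attacks   = λ x y → ⇔-id _
    }

  -- Completions as runs of `makeComp`

  Uncertain : Pred (Prp n) 0ℓ
  Uncertain = (_∈ˡ AW A?) Pred.∪ (_∈ˡ ATT R?) Pred.∪ (_∈ˡ ATT R↔)

  ⟦makeComp⟧ : ⟦ makeComp caf ⟧ v w ⇔ (Assigns true Uncertain v w ×
    ∀ x y → (x , y) ∈ʳ R↔ → w (r x y) ≡ true ⊎ w (r y x) ≡ true)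
  ⟦makeComp⟧ {v} {w} = mk⇔
    (λ (u , vu , t , ut , tw) →
      let t⇝w , some = to (⟦dis⟧ R↔ R↔-sym) tw in
      to (Assigns-∪ (_∈ˡ? _)) (u , to (⟦mkSome⟧ true) vu ,
        to (Assigns-∪ (_∈ˡ? _)) (t , to (⟦mkSome⟧ true) ut , t⇝w)) ,
      some)
    (λ (v⇝w , some) →
      let u , vu , u⇝w = from (Assigns-∪ (_∈ˡ? _)) v⇝w
          t , ut , t⇝w = from (Assigns-∪ (_∈ˡ? _)) u⇝w in
      u , from (⟦mkSome⟧ true) vu , t , from (⟦mkSome⟧ true) ut ,
      from (⟦dis⟧ R↔ R↔-sym) (t⇝w , some))

  uncertain-aw : ∀ {x} → Uncertain (aw x) → x ∈ A?
  uncertain-aw (inj₁ p∈) with ∈-AW⁻ A? p∈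
  ... | _ , x∈A? , refl = x∈A?
  uncertain-aw (inj₂ (inj₁ p∈)) with ∈-ATT⁻ R? p∈
  ... | _ , _ , _ , ()
  uncertain-aw (inj₂ (inj₂ p∈)) with ∈-ATT⁻ R↔ p∈
  ... | _ , _ , _ , ()

  uncertain-r : ∀ {x y} → Uncertain (r x y) → (x , y) ∈ʳ (R? ∪ʳ R↔)
  uncertain-r (inj₁ p∈) with ∈-AW⁻ A? p∈
  ... | _ , _ , ()
  uncertain-r (inj₂ (inj₁ p∈)) with ∈-ATT⁻ R? p∈
  ... | _ , _ , xy∈ , refl = from (∈-∪ʳ R? R↔ _ _) (inj₁ xy∈)
  uncertain-r (inj₂ (inj₂ p∈)) with ∈-ATT⁻ R↔ p∈
  ... | _ , _ , xy∈ , refl = from (∈-∪ʳ R? R↔ _ _) (inj₂ xy∈)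

  module _ {CFG : Subset n} (CFG⊆Aᶜ : CFG ⊆ Aᶜ) {w : Valuation n} (conf : Configured CFG w) where
    open Configured conf

    private
      caf′ : CAF n
      caf′ = configure caf CFG CFG⊆Aᶜ

      V : Subset n
      V = Aᶠ ∪ A? ∪ CFG

      reading : Valuation n → Attacks n
      reading u x y = u (r x y)

      framework : Valuation n → AF n
      framework u = record
        { A     = labelled aw u
        ; R     = reading u ↾ labelled aw u
        ; R⊆A×A = λ x y → from (∈-⊠ (labelled aw u) (labelled aw u) x y) ∘
            proj₂ ∘ to (∈-↾ (reading u) (labelled aw u) x y)
        }

    Encodes-framework : ∀ u → Encodes u (framework u)
    Encodes-framework u = record
      { arguments = Labels-labelled aw u
      ; attacks   = λ {x} {y} x∈A y∈A → mk⇔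
          (λ t → from (∈-↾ (reading u) (labelled aw u) x y) (t , x∈A , y∈A))
          (proj₁ ∘ to (∈-↾ (reading u) (labelled aw u) x y))
      }

    -- Between arguments of a completion, `Rᶜ` and its restriction to `V` therefore coincide, which
    -- reconciles the unrestricted `Rᶜ` of the valuation with that of the configured framework.
    upper⊆V : Aᶠ ∪ CFG ∪ A? ⊆ V
    upper⊆V x∈ with x∈p∪q⁻ Aᶠ (CFG ∪ A?) x∈
    ... | inj₁ x∈Aᶠ = x∈p∪q⁺ (inj₁ x∈Aᶠ)
    ... | inj₂ x∈′ with x∈p∪q⁻ CFG A? x∈′
    ...   | inj₁ x∈CFG = x∈p∪q⁺ (inj₂ (x∈p∪q⁺ (inj₂ x∈CFG)))
    ...   | inj₂ x∈A?  = x∈p∪q⁺ (inj₂ (x∈p∪q⁺ (inj₁ x∈A?)))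

    makeComp-sound : ∀ {u} → ⟦ makeComp caf ⟧ w u → Completion caf′ (framework u)
    makeComp-sound {u} wu = record
      { A-lower = λ {x} → lower x ∘ x∈p∪q⁻ Aᶠ CFG
      ; A-upper = upper
      ; R-lower = λ x y xy∈ → let fc , xy∈A = to (∈-↾ (Rᶠ ∪ʳ (Rᶜ ↾ V)) (labelled aw u) x y) xy∈ in
          from (∈-↾ (reading u) (labelled aw u) x y)
            (Assigns-true-mono w⇝u (r x y) (from (attacks x y) (from (∈-∪ʳ Rᶠ Rᶜ x y)
              (Sum.map₂ (proj₁ ∘ to (∈-↾ Rᶜ V x y)) (to (∈-∪ʳ Rᶠ (Rᶜ ↾ V) x y) fc)))) , xy∈A)
      ; R-upper = λ x y xy∈ → let t , x∈A , y∈A = to (∈-↾ (reading u) (labelled aw u) x y) xy∈ in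
          from (∈-↾ (Rᶠ ∪ʳ (Rᶜ ↾ V) ∪ʳ R? ∪ʳ R↔) (labelled aw u) x y)
            (possible x y t x∈A y∈A , x∈A , y∈A)
      ; R↔-some = λ x y x∈A y∈A xy∈ → Sum.map
          (λ e → from (∈-↾ (reading u) (labelled aw u) x y) (from T-≡ e , x∈A , y∈A))
          (λ e → from (∈-↾ (reading u) (labelled aw u) y x) (from T-≡ e , y∈A , x∈A)) (some x y xy∈)
      }
      where
      w⇝u : Assigns true Uncertain w u
      w⇝u = proj₁ (to ⟦makeComp⟧ wu)

      some : ∀ x y → (x , y) ∈ʳ R↔ → u (r x y) ≡ true ⊎ u (r y x) ≡ true
      some = proj₂ (to ⟦makeComp⟧ wu)

      lower : ∀ x → x ∈ Aᶠ ⊎ x ∈ CFG → x ∈ labelled aw u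
      lower x = to (Labels-labelled aw u x) ∘ Assigns-true-mono w⇝u (aw x) ∘ from (arguments x)

      upper : labelled aw u ⊆ Aᶠ ∪ CFG ∪ A?
      upper {x} x∈ with Assigns-true-new w⇝u (aw x) (from (Labels-labelled aw u x) x∈)
      ... | inj₂ new = x∈p∪q⁺ (inj₂ (x∈p∪q⁺ (inj₂ (uncertain-aw new))))
      ... | inj₁ t with to (arguments x) t
      ...   | inj₁ x∈Aᶠ  = x∈p∪q⁺ (inj₁ x∈Aᶠ)
      ...   | inj₂ x∈CFG = x∈p∪q⁺ (inj₂ (x∈p∪q⁺ (inj₁ x∈CFG)))

      possible : ∀ x y → T (u (r x y)) → x ∈ labelled aw u → y ∈ labelled aw u →
                 (x , y) ∈ʳ (Rᶠ ∪ʳ (Rᶜ ↾ V) ∪ʳ R? ∪ʳ R↔)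
      possible x y t x∈A y∈A = from (∈-∪ʳ Rᶠ ((Rᶜ ↾ V) ∪ʳ R? ∪ʳ R↔) x y)
        (Sum.map₂ (from (∈-∪ʳ (Rᶜ ↾ V) (R? ∪ʳ R↔) x y)) cases)
        where
        cases : (x , y) ∈ʳ Rᶠ ⊎ (x , y) ∈ʳ (Rᶜ ↾ V) ⊎ (x , y) ∈ʳ (R? ∪ʳ R↔)
        cases with Assigns-true-new w⇝u (r x y) t
        ... | inj₂ new = inj₂ (inj₂ (uncertain-r new))
        ... | inj₁ old with to (∈-∪ʳ Rᶠ Rᶜ x y) (to (attacks x y) old)
        ...   | inj₁ xy∈Rᶠ = inj₁ xy∈Rᶠ
        ...   | inj₂ xy∈Rᶜ = inj₂ (inj₁ (from (∈-↾ Rᶜ V x y)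
                (xy∈Rᶜ , upper⊆V (upper x∈A) , upper⊆V (upper y∈A))))

    module _ {F : AF n} (comp : Completion caf′ F) where
      open AF F renaming (A to A*; R to R*)
      open Completion comp

      private
        -- dis works on all of R↔, so the pairs of R↔ outside A* have to be
        -- switched on as well; no formula can see them.
        hidden : Attacks n
        hidden x y = R↔ x y Bool.∧ Bool.not ((A* ⊠ A*) x y)

        completed : Valuation n
        completed (aw x)    = lookup A* x
        completed (inn x)   = w (inn x)
        completed (inn′ x)  = w (inn′ x)
        -- `Rᶠ ∪ʳ Rᶜ` is on from the start and `makeComp` turns nothing off, so these attacks must
        -- be kept even where an end is absent.
        completed (r x y)   = (R* ∪ʳ (Rᶠ ∪ʳ Rᶜ) ∪ʳ hidden) x y
        completed (other k) = w (other k)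

        completed-r : ∀ x y → T (completed (r x y)) ⇔
          ((x , y) ∈ʳ R* ⊎ (x , y) ∈ʳ (Rᶠ ∪ʳ Rᶜ) ⊎ (x , y) ∈ʳ hidden)
        completed-r x y =
          (⇔-id _ ⊎-⇔ ∈-∪ʳ (Rᶠ ∪ʳ Rᶜ) hidden x y) ⇔-∘ ∈-∪ʳ R* ((Rᶠ ∪ʳ Rᶜ) ∪ʳ hidden) x y

        ∈-hidden : ∀ x y → (x , y) ∈ʳ hidden ⇔ ((x , y) ∈ʳ R↔ × ¬ (x ∈ A* × y ∈ A*))
        ∈-hidden x y = (⇔-id _ ×-⇔ (T⇔⇒≡false (∈-⊠ A* A* x y) ⇔-∘ T-not-≡)) ⇔-∘ T-∧

        mono : ∀ p → T (w p) → T (completed p)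
        mono (aw x)    t = to (∈⇔lookup A*) (A-lower (x∈p∪q⁺ (to (arguments x) t)))
        mono (inn x)   t = t
        mono (inn′ x)  t = t
        mono (r x y)   t = from (completed-r x y) (inj₂ (inj₁ (to (attacks x y) t)))
        mono (other k) t = t

        new : ∀ p → T (completed p) → T (w p) ⊎ Uncertain p
        new (inn x)   t = inj₁ t
        new (inn′ x)  t = inj₁ t
        new (other k) t = inj₁ t
        new (aw x)    t with x∈p∪q⁻ Aᶠ (CFG ∪ A?) (A-upper (from (∈⇔lookup A*) t))
        ... | inj₁ x∈Aᶠ = inj₁ (from (arguments x) (inj₁ x∈Aᶠ))
        ... | inj₂ x∈ with x∈p∪q⁻ CFG A? x∈
        ...   | inj₁ x∈CFG = inj₁ (from (arguments x) (inj₂ x∈CFG))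
        ...   | inj₂ x∈A?  = inj₂ (inj₁ (∈-AW⁺ A? x∈A?))
        new (r x y)   t with to (completed-r x y) t
        ... | inj₂ (inj₁ xy∈) = inj₁ (from (attacks x y) xy∈)
        ... | inj₂ (inj₂ xy∈) = inj₂ (inj₂ (inj₂ (∈-ATT⁺ R↔ (proj₁ (to (∈-hidden x y) xy∈)))))
        ... | inj₁ xy∈R* with to (∈-∪ʳ Rᶠ ((Rᶜ ↾ V) ∪ʳ R? ∪ʳ R↔) x y)
              (proj₁ (to (∈-↾ (Rᶠ ∪ʳ (Rᶜ ↾ V) ∪ʳ R? ∪ʳ R↔) A* x y) (R-upper x y xy∈R*)))
        ...   | inj₁ xy∈Rᶠ = inj₁ (from (attacks x y) (from (∈-∪ʳ Rᶠ Rᶜ x y) (inj₁ xy∈Rᶠ)))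
        ...   | inj₂ rest with to (∈-∪ʳ (Rᶜ ↾ V) (R? ∪ʳ R↔) x y) rest
        ...     | inj₁ xy∈Rᶜ = inj₁ (from (attacks x y)
                  (from (∈-∪ʳ Rᶠ Rᶜ x y) (inj₂ (proj₁ (to (∈-↾ Rᶜ V x y) xy∈Rᶜ)))))
        ...     | inj₂ xy∈U  = inj₂ (inj₂
                  (Sum.map (∈-ATT⁺ R?) (∈-ATT⁺ R↔) (to (∈-∪ʳ R? R↔ x y) xy∈U)))

        some : ∀ x y → (x , y) ∈ʳ R↔ → completed (r x y) ≡ true ⊎ completed (r y x) ≡ true
        some x y xy∈ with (x ∈? A*) ×-dec (y ∈? A*)
        ... | no xy∉A = inj₁ (to T-≡ (from (completed-r x y)
          (inj₂ (inj₂ (from (∈-hidden x y) (xy∈ , xy∉A))))))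
        ... | yes (x∈A , y∈A) = Sum.map (to T-≡ ∘ from (completed-r x y) ∘ inj₁)
          (to T-≡ ∘ from (completed-r y x) ∘ inj₁) (R↔-some x y x∈A y∈A xy∈)

        -- The two additions to `R*` are invisible on `A*`: fixed and control attacks between
        -- present arguments are forced into `R*` by its lower bound, and `hidden` excludes such
        -- pairs.
        attacks* : ∀ {x y} → x ∈ A* → y ∈ A* → T (completed (r x y)) → (x , y) ∈ʳ R*
        attacks* {x} {y} x∈A y∈A t with to (completed-r x y) t
        ... | inj₁ xy∈R*      = xy∈R*
        ... | inj₂ (inj₂ xy∈) = contradiction (x∈A , y∈A) (proj₂ (to (∈-hidden x y) xy∈))
        ... | inj₂ (inj₁ xy∈) = R-lower x y (from (∈-↾ (Rᶠ ∪ʳ (Rᶜ ↾ V)) A* x y)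
          (from (∈-∪ʳ Rᶠ (Rᶜ ↾ V) x y) (Sum.map₂
            (λ xy∈Rᶜ → from (∈-↾ Rᶜ V x y) (xy∈Rᶜ , upper⊆V (A-upper x∈A) , upper⊆V (A-upper y∈A)))
            (to (∈-∪ʳ Rᶠ Rᶜ x y) xy∈)) , x∈A , y∈A))

      makeComp-complete : ∃ λ u → ⟦ makeComp caf ⟧ w u × Encodes u F
      makeComp-complete = completed , from ⟦makeComp⟧ (Assigns-true⁺ mono new , some) , record
        { arguments = λ x → ⇔-sym (∈⇔lookup A*)
        ; attacks   = λ x∈A y∈A → mk⇔ (attacks* x∈A y∈A) (from (completed-r _ _) ∘ inj₁)
        }

    module _ {Q : Pred (AF n) 0ℓ} (φ : Formula n) (Q⇔φ : ∀ F u → Encodes u F → Q F ⇔ (u ⊨ φ)) where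

      -- Runs and completions are not in bijection. It is enough that each run encodes some
      -- completion, that each completion is encoded by some run, and that `Q` agrees with `φ` at
      -- every encoding.
      ⊨-[makeComp] : (∀ F → Completion caf′ F → Q F) ⇔ (w ⊨ [ makeComp caf ] φ)
      ⊨-[makeComp] = mk⇔
        (λ h u wu → to (Q⇔φ _ u (Encodes-framework u)) (h (framework u) (makeComp-sound wu)))
        (λ h F comp → let u , wu , enc = makeComp-complete comp in from (Q⇔φ F u enc) (h u wu))

      ⊨-⟨makeComp⟩ : (∃ λ F → Completion caf′ F × Q F) ⇔ (w ⊨ ⟨ makeComp caf ⟩ φ)
      ⊨-⟨makeComp⟩ = ⇔-sym (⊨-⟨⟩ (makeComp caf) φ w) ⇔-∘ mk⇔ run complete
        where
        run : (∃ λ F → Completion caf′ F × Q F) → ∃ λ u → ⟦ makeComp caf ⟧ w u × (u ⊨ φ)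
        run (F , comp , QF) =
          let u , wu , enc = makeComp-complete comp in u , wu , to (Q⇔φ F u enc) QF

        complete : (∃ λ u → ⟦ makeComp caf ⟧ w u × (u ⊨ φ)) → ∃ λ F → Completion caf′ F × Q F
        complete (u , wu , u⊨φ) =
          framework u , makeComp-sound wu , from (Q⇔φ _ u (Encodes-framework u)) u⊨φ

  ⊨-⟨control⟩ : ∀ {Q : ∀ CFG → CFG ⊆ Aᶜ → Set} φ →
    (∀ CFG (CFG⊆Aᶜ : CFG ⊆ Aᶜ) w → Configured CFG w → Q CFG CFG⊆Aᶜ ⇔ (w ⊨ φ)) →
    (∃₂ λ CFG (CFG⊆Aᶜ : CFG ⊆ Aᶜ) → Q CFG CFG⊆Aᶜ) ⇔ (valuation caf ⊨ ⟨ control caf ⟩ φ)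
  ⊨-⟨control⟩ {Q} φ Q⇔φ = ⇔-sym (⊨-⟨⟩ (control caf) φ (valuation caf)) ⇔-∘ mk⇔ run configuration
    where
    run : (∃₂ λ CFG (CFG⊆Aᶜ : CFG ⊆ Aᶜ) → Q CFG CFG⊆Aᶜ) →
          ∃ λ w → ⟦ control caf ⟧ (valuation caf) w × (w ⊨ φ)
    run (CFG , CFG⊆Aᶜ , q) = configured CFG , control-complete CFG⊆Aᶜ ,
      to (Q⇔φ CFG CFG⊆Aᶜ _ (Configured-configured CFG)) q

    configuration : (∃ λ w → ⟦ control caf ⟧ (valuation caf) w × (w ⊨ φ)) →
                    ∃₂ λ CFG (CFG⊆Aᶜ : CFG ⊆ Aᶜ) → Q CFG CFG⊆Aᶜ
    configuration (w , vw , w⊨φ) = let CFG , CFG⊆Aᶜ , conf = control-sound vw in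
      CFG , CFG⊆Aᶜ , from (Q⇔φ CFG CFG⊆Aᶜ w conf) w⊨φ

-- Acceptance within one framework, and the four problems

module _ {F : AF n} {φ : Formula n} {S : Pred (Subset n) 0ℓ}
         (ex : Expresses F φ S) (a : Fin n) where

  ⊨-[makeExtOf] : Encodes v F → (∀ E → S E → a ∈ E) ⇔ (v ⊨ [ makeExtOf φ ] var (inn a))
  ⊨-[makeExtOf] {v} enc = mk⇔
    (λ h w vw → from (Labels-labelled inn w a) (h _ (makeExtOf-sound ex enc vw)))
    (λ h E SE → to (Labels-relabel E v a) (h _ (makeExtOf-complete ex enc SE)))

  ⊨-⟨makeExtOf⟩ : Encodes v F → (∃ λ E → S E × a ∈ E) ⇔ (v ⊨ ⟨ makeExtOf φ ⟩ var (inn a))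
  ⊨-⟨makeExtOf⟩ {v} enc = ⇔-sym (⊨-⟨⟩ (makeExtOf φ) (var (inn a)) v) ⇔-∘ mk⇔ run extension
    where
    run : (∃ λ E → S E × a ∈ E) → ∃ λ w → ⟦ makeExtOf φ ⟧ v w × (w ⊨ var (inn a))
    run (E , SE , a∈E) =
      relabel E v , makeExtOf-complete ex enc SE , from (Labels-relabel E v a) a∈E

    extension : (∃ λ w → ⟦ makeExtOf φ ⟧ v w × (w ⊨ var (inn a))) → ∃ λ E → S E × a ∈ E
    extension (w , vw , t) =
      labelled inn w , makeExtOf-sound ex enc vw , to (Labels-labelled inn w a) t

proposition11 : (n : ℕ) .{{_ : NonZero n}} (σ : Semantics) (caf : CAF n) (a : Fin n) →
    a ∈ CAF.Aᶠ caf →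
    (NSCon σ caf a ⇔ (valuation caf ⊨ ⟨ control caf ⟩ [ makeComp caf ⨾ makeExt σ ] var (inn a))) ×
    (NCCon σ caf a ⇔ (valuation caf ⊨ ⟨ control caf ⟩ [ makeComp caf ] ⟨ makeExt σ ⟩ var (inn a))) ×
    (PCCon σ caf a ⇔ (valuation caf ⊨ ⟨ control caf ⨾ makeComp caf ⨾ makeExt σ ⟩ var (inn a))) ×
    (PSCon σ caf a ⇔ (valuation caf ⊨ ⟨ control caf ⨾ makeComp caf ⟩ [ makeExt σ ] var (inn a)))
proposition11 n σ caf a _ =
  -- The transfer lemmas treat one quantifier each (configuration, completion, extension), so
  -- composite programs are matched with nested modalities.
  ⊨-⟨control⟩ caf ([ comp ⨾ ext ] goal) (λ CFG CFG⊆Aᶜ w conf →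
    ⊨-[⨾] comp ext goal w ⇔-∘ ⊨-[makeComp] caf CFG⊆Aᶜ conf ([ ext ] goal) skeptical) ,
  ⊨-⟨control⟩ caf ([ comp ] ⟨ ext ⟩ goal) (λ CFG CFG⊆Aᶜ w conf →
    ⊨-[makeComp] caf CFG⊆Aᶜ conf (⟨ ext ⟩ goal) credulous) ,
  (⊨-⟨⨾⟩ (control caf) (comp ⨾ ext) goal (valuation caf) ⇔-∘
   ⊨-⟨control⟩ caf (⟨ comp ⨾ ext ⟩ goal) (λ CFG CFG⊆Aᶜ w conf →
    ⊨-⟨⨾⟩ comp ext goal w ⇔-∘ ⊨-⟨makeComp⟩ caf CFG⊆Aᶜ conf (⟨ ext ⟩ goal) credulous)) ,
  (⊨-⟨⨾⟩ (control caf) comp ([ ext ] goal) (valuation caf) ⇔-∘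
   ⊨-⟨control⟩ caf (⟨ comp ⟩ [ ext ] goal) (λ CFG CFG⊆Aᶜ w conf →
    ⊨-⟨makeComp⟩ caf CFG⊆Aᶜ conf ([ ext ] goal) skeptical))
  where
  comp ext : Program n
  comp = makeComp caf
  ext  = makeExt σ

  goal : Formula n
  goal = var (inn a)

  skeptical : ∀ F u → Encodes u F → (∀ E → Extension σ F E → a ∈ E) ⇔ (u ⊨ [ ext ] goal)
  skeptical F u = ⊨-[makeExtOf] (expresses-extension σ) a

  credulous : ∀ F u → Encodes u F → (∃ λ E → Extension σ F E × a ∈ E) ⇔ (u ⊨ ⟨ ext ⟩ goal)
  credulous F u = ⊨-⟨makeExtOf⟩ (expresses-extension σ) a
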